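{- Let $n\geq1$, $P_n=\{(i,j)\in[n]^2: i<j\}$ with $[n]=\{0,\ldots,n\}$, and $I\subset P_n$. Let $A_{I,n}$ be the set of total cyclic orders $\pi$ on $[n]$ such that $(i,i+1,\ldots,j)$ is a $\pi$-chain for every $(i,j)\in I$, and let $B_{I,n}=\{x\in[0,1]^n : x_{i+1}+\cdots+x_j\leq1 \text{ for all }(i,j)\in I\}$. Then \[ E^*(B_{I,n},z)=\sum_{\pi\in A_{I,n}} z^{\mathrm{des}(\underline{\pi})}. \]
   Context: A cyclic order on $X$ is a set $\pi\subset X^3$ with: (i) $(x,y,z)\in\pi\Rightarrow(y,z,x)\in\pi$; (ii) $(x,y,z)\in\pi\Rightarrow(z,y,x)\notin\pi$; (iii) $(x,y,z),(x,z,u)\in\pi\Rightarrow(x,y,u)\in\pi$; it is total if for all distinct $x,y,z$ either $(x,y,z)\in\pi$ or $(z,y,x)\in\pi$. For $m\geq3$, $(x_1,\ldots,x_m)$ (distinct elements) is a $\pi$-chain if $(x_1,x_i,x_{i+1})\in\pi$ for $2\leq i\leq m-1$; any pair of distinct elements is a $\pi$-chain. For a total cyclic order $\pi$ on $[n]$, $\underline{\pi}=(w_0,\ldots,w_n)$ is the unique word of distinct letters of $[n]$ with $w_0=0$ such that $(w_0,w_1,\ldots,w_n)$ is a $\pi$-chain (reading the elements around the circle clockwise starting from $0$). For such a word, $\mathrm{des}(\underline{w})$ is the number of positions $0\leq i\leq n-1$ with $w_{i+1}<w_i$. For a lattice polytope $P\subset\mathbb{R}^n$, $E(P,t)=\#(tP\cap\mathbb{Z}^n)$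 for integers $t\geq0$, and the Ehrhart $h^*$-polynomial is $E^*(P,z)=(1-z)^{n+1}\sum_{t\geq0}E(P,t)z^t$. -}

module Defs where

open import Data.Nat using (ℕ; zero; suc; _+_; _*_; _∸_; _<ᵇ_; _≡ᵇ_; _≤ᵇ_)
open import Data.Bool using (Bool; true; false; _∧_; _∨_; not; if_then_else_)
open import Data.List using (List; []; _∷_; map; concatMap; allFin; upTo; length; filterᵇ; foldr; cartesianProduct)
open import Data.Nat.ListAction using (sum)
open import Data.Fin using (Fin; toℕ)
import Data.Fin as F
open import Data.Product using (_×_; _,_)
open import Data.Integer as ℤ using (ℤ)

-- all functions Fin a → B whose values lie in the list bs (no duplicates
-- up to extensional equality when bs has none)
funs : (a : ℕ) {B : Set} → List B → List (Fin a → B)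
funs zero     bs = (λ ()) ∷ []
funs (suc a) {B} bs =
  concatMap (λ b → map (cons b) (funs a bs)) bs
  where
  cons : B → (Fin a → B) → Fin (suc a) → B
  cons b f F.zero    = b
  cons b f (F.suc i) = f i

allᵇ : {A : Set} → List A → (A → Bool) → Bool
allᵇ xs p = foldr (λ x acc → p x ∧ acc) true xs

count : {A : Set} → List A → (A → Bool) → ℕ
count xs p = length (filterᵇ p xs)

_⇒ᵇ_ : Bool → Bool → Bool
a ⇒ᵇ b = not a ∨ b

-- [n] = {0,…,n} is Fin (suc n); a ternary relation π ⊆ [n]^3 is a
-- Bool-valued function (its characteristic function).

Pt : ℕ → Set
Pt n = Fin (suc n)

Rel3 : ℕ → Set
Rel3 n = Pt n → Pt n → Pt n → Bool

pts : (n : ℕ) → List (Pt n)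
pts n = allFin (suc n)

allRel3 : (n : ℕ) → List (Rel3 n)
allRel3 n = funs (suc n) (funs (suc n) (funs (suc n) (true ∷ false ∷ [])))

_≟ᵇ_ : {n : ℕ} → Pt n → Pt n → Bool
x ≟ᵇ y = toℕ x ≡ᵇ toℕ y

isTotalCyclicOrder : (n : ℕ) → Rel3 n → Bool
isTotalCyclicOrder n π =
  allᵇ (pts n) λ x → allᵇ (pts n) λ y → allᵇ (pts n) λ z →
    (π x y z ⇒ᵇ π y z x)
    ∧ (π x y z ⇒ᵇ not (π z y x))
    ∧ allᵇ (pts n) (λ u → (π x y z ∧ π x z u) ⇒ᵇ π x y u)
    ∧ ((not (x ≟ᵇ y) ∧ not (y ≟ᵇ z) ∧ not (x ≟ᵇ z)) ⇒ᵇ (π x y z ∨ π z y x))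

-- (i, i+1, …, j) is a π-chain (i < j): (i, k, k+1) ∈ π for i < k, k+1 ≤ j.
-- (When j = i+1 it is a pair, hence always a chain.)
intervalChain : (n : ℕ) → Rel3 n → Pt n → Pt n → Bool
intervalChain n π i j =
  allᵇ (pts n) λ k → allᵇ (pts n) λ k' →
    ((toℕ i <ᵇ toℕ k) ∧ (toℕ k' ≡ᵇ suc (toℕ k)) ∧ (toℕ k' ≤ᵇ toℕ j)) ⇒ᵇ π i k k'

inA : (n : ℕ) → (Pt n → Pt n → Bool) → Rel3 n → Bool
inA n I π =
  isTotalCyclicOrder n π
  ∧ allᵇ (pts n) (λ i → allᵇ (pts n) (λ j → I i j ⇒ᵇ intervalChain n π i j))

Word : ℕ → Set
Word n = Pt n → Pt n

allWords : (n : ℕ) → List (Word n)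
allWords n = funs (suc n) (pts n)

-- w has distinct letters, w_0 = 0, and (w_0,…,w_n) is a π-chain:
-- (w_0, w_a, w_{a+1}) ∈ π for 1 ≤ a ≤ n-1.  So w = underline π.
isUnderline : (n : ℕ) → Rel3 n → Word n → Bool
isUnderline n π w =
  (toℕ (w F.zero) ≡ᵇ 0)
  ∧ allᵇ (pts n) (λ a → allᵇ (pts n) (λ b → (w a ≟ᵇ w b) ⇒ᵇ (a ≟ᵇ b)))
  ∧ allᵇ (pts n) (λ a → allᵇ (pts n) (λ b →
      ((1 ≤ᵇ toℕ a) ∧ (toℕ b ≡ᵇ suc (toℕ a))) ⇒ᵇ π (w F.zero) (w a) (w b)))

des : (n : ℕ) → Word n → ℕ
des n w = count (cartesianProduct (pts n) (pts n)) λ where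
  (a , b) → (toℕ b ≡ᵇ suc (toℕ a)) ∧ (toℕ (w b) <ᵇ toℕ (w a))

-- coefficient of z^m in Σ_{π ∈ A_{I,n}} z^{des(underline π)}, computed as the
-- number of pairs (π, w) with π ∈ A_{I,n}, w = underline π, des w = m
-- (underline π exists and is unique for total cyclic orders π).
descentCount : (n : ℕ) → (Pt n → Pt n → Bool) → ℕ → ℕ
descentCount n I m =
  count (cartesianProduct (allRel3 n) (allWords n)) λ where
    (π , w) → inA n I π ∧ isUnderline n π w ∧ (des n w ≡ᵇ m)

-- Ehrhart side.  Coordinates x_1,…,x_n are stored 0-indexed as
-- x : Fin n → ℕ (x_{k+1} = x k).

segSum : {n : ℕ} → (Fin n → ℕ) → ℕ → ℕ → ℕ
segSum {n} x i j =
  sum (map (λ k → if (i ≤ᵇ toℕ k) ∧ (toℕ k <ᵇ j) then x k else 0) (allFin n))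

-- E(B_{I,n}, t) = #(t B_{I,n} ∩ ℤ^n)
--   = #{ y ∈ ℤ^n : 0 ≤ y_k ≤ t, y_{i+1}+⋯+y_j ≤ t for (i,j) ∈ I }
ehrhart : (n : ℕ) → (Pt n → Pt n → Bool) → ℕ → ℕ
ehrhart n I t =
  count (funs n (allFin (suc t))) λ y →
    allᵇ (pts n) λ i → allᵇ (pts n) λ j →
      I i j ⇒ᵇ (segSum (λ k → toℕ (y k)) (toℕ i) (toℕ j) ≤ᵇ t)

binom : ℕ → ℕ → ℕ
binom n       zero    = 1
binom zero    (suc k) = 0
binom (suc n) (suc k) = binom n k + binom n (suc k)

sign : ℕ → ℤ
sign zero    = ℤ.+ 1
sign (suc j) = ℤ.- sign j

-- coefficient of z^m in E*(P,z) = (1-z)^{n+1} Σ_t E(P,t) z^t :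
--   Σ_{j=0}^{m} (-1)^j C(n+1,j) E(P, m-j)
hstarCoeff : (n : ℕ) → (ℕ → ℕ) → ℕ → ℤ
hstarCoeff n E m =
  foldr ℤ._+_ (ℤ.+ 0)
    (map (λ j → sign j ℤ.* ℤ.+ (binom (suc n) j * E (m ∸ j))) (upTo (suc m)))

{-# OPTIONS --safe #-}
-- Fix t. A lattice point y of the t-th dilate of the unit cube is encoded by its partial sums
-- modulo t + 1, ρ 0 = 0 and ρ (k + 1) = ρ k + y k mod t + 1; this is a bijection onto sequences
-- in {0,…,t}, and the sum of y over a segment from i to j is at most t exactly when ρ goes round
-- the circle ℤ/(t+1) less than once on i,…,j. Breaking ties between equal values by the labels,
-- ρ puts a total cyclic order π on {0,…,n}, and the latter condition says that (i,…,j) is a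
-- π-chain. The word w = underline π is the stable sort of ρ, so the points y inducing a given π
-- correspond to sequences 0 ≤ c 1 ≤ … ≤ c n ≤ t, strictly increasing at the descents of w;
-- counting them amounts to n + 1 prefix summations of the indicator of des w, which are undone by
-- multiplication with (1 - z)^(n+1).
module Submission where

open import Defs
open import Data.Bool using (Bool; true; false; T; _∧_; _∨_; not; if_then_else_)
open import Data.Bool.Properties using (T-∧; T-∨; T-≡)
open import Data.Empty using (⊥-elim)
open import Data.Fin using (Fin; zero; suc; toℕ; inject₁; fromℕ<; punchIn; punchOut)
open import Data.Fin.Properties using (toℕ-injective; toℕ-inject₁; toℕ<n; toℕ-fromℕ<; toℕ≤pred[n]; injective⇒≤)
open import Data.Fin.Properties using (punchOut-injective; punchIn-injective; punchInᵢ≢i; any?; _≟_)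
import Data.Integer as ℤ
import Data.Integer.Properties as ℤ
open import Data.Integer.Solver using () renaming (module +-*-Solver to ℤ-Solver)
open import Data.List using (List; []; _∷_; _++_; map; concatMap; allFin; tabulate; cartesianProduct; foldr; applyUpTo)
open import Data.List.Properties using (map-tabulate)
open import Data.Nat hiding (_≟_)
open import Data.Nat.ListAction using (sum)
open import Data.Nat.Properties hiding (_≟_)
open import Data.Nat.Solver using (module +-*-Solver)
open import Data.Product using (_×_; _,_; proj₁; proj₂; ∃; Σ)
open import Data.Sum as Sum using (_⊎_; inj₁; inj₂)
open import Function using (_∘_; id; _⇔_; mk⇔; Equivalence)
open import Relation.Binary using (tri<; tri≈; tri>)
open import Relation.Binary.PropositionalEquality
open import Relation.Nullary using (¬_; yes; no; contradiction)

open Equivalence using (to; from)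

-- The modulus is t + 1 because a coordinate takes the t + 1 values 0,...,t: every step between
-- residues is then the increment of exactly one admissible `y k`, and a step 0 is told apart from a
-- step t. Ties are the delicate point. Offsets along the walk compare weakly, since a step 0 is
-- allowed, whereas a cyclic order is strict. Breaking ties by increasing labels reconciles the two
-- because labels increase along an interval, and the same convention makes the inequalities strict
-- at exactly the descents of w. The count itself is a double count of incidences between points y
-- and pairs (π , w) with w sorting y: over the pairs it gives 1 if y lies in the dilate and 0
-- otherwise, over y it gives the contribution of π. Functions occur as members of enumerating lists
-- and are compared pointwise, so existence and uniqueness in these lists is phrased as a sum of
-- Boolean indicators equal to 1.

infix 4 _≐_
_≐_ : {A B : Set} → (A → B) → (A → B) → Set
f ≐ g = ∀ x → f x ≡ g x

-- Booleans

T-ext : ∀ {a b} → (T a → T b) → (T b → T a) → a ≡ b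
T-ext {false} {false} _ _ = refl
T-ext {false} {true}  _ g with () ← g _
T-ext {true}  {false} f _ with () ← f _
T-ext {true}  {true}  _ _ = refl

T-⇒ : ∀ {a b} → T (a ⇒ᵇ b) ⇔ (T a → T b)
T-⇒ {false}         = mk⇔ (λ _ ()) (λ _ → _)
T-⇒ {true}  {false} = mk⇔ (λ ()) (λ f → f _)
T-⇒ {true}  {true}  = mk⇔ _ _

-- Recursion on `n` itself, in step with `funs`; `allᵇ` over `allFin` unfolds to a tabulation of
-- `suc` instead of the same expression one size down.
allFinᵇ : ∀ {n} → (Fin n → Bool) → Bool
allFinᵇ {zero}  p = true
allFinᵇ {suc n} p = p zero ∧ allFinᵇ (p ∘ suc)

T-allFinᵇ : ∀ {n} (p : Fin n → Bool) → T (allFinᵇ p) ⇔ (∀ x → T (p x))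
T-allFinᵇ {zero}  p = mk⇔ (λ _ ()) (λ _ → _)
T-allFinᵇ {suc n} p = mk⇔ f g
  where
  f : T (p zero ∧ allFinᵇ (p ∘ suc)) → ∀ x → T (p x)
  f h zero    = proj₁ (to T-∧ h)
  f h (suc x) = to (T-allFinᵇ (p ∘ suc)) (proj₂ (to T-∧ h)) x
  g : (∀ x → T (p x)) → T (p zero ∧ allFinᵇ (p ∘ suc))
  g h = from T-∧ (h zero , from (T-allFinᵇ (p ∘ suc)) (h ∘ suc))

allᵇ-tabulate : ∀ {A : Set} {n} (f : Fin n → A) (p : A → Bool) → allᵇ (tabulate f) p ≡ allFinᵇ (p ∘ f)
allᵇ-tabulate {n = zero}  f p = refl
allᵇ-tabulate {n = suc n} f p = cong (p (f zero) ∧_) (allᵇ-tabulate (f ∘ suc) p)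

T-all : ∀ {n} (p : Fin n → Bool) → T (allᵇ (allFin n) p) ⇔ (∀ x → T (p x))
T-all p = mk⇔
  (λ h → to (T-allFinᵇ p) (subst T (allᵇ-tabulate id p) h))
  (λ h → subst T (sym (allᵇ-tabulate id p)) (from (T-allFinᵇ p) h))

-- Sums over lists

ind : Bool → ℕ
ind b = if b then 1 else 0

ind-∧ : ∀ a b → ind (a ∧ b) ≡ ind a * ind b
ind-∧ false b = refl
ind-∧ true  b = sym (+-identityʳ _)

∑ : {A : Set} → List A → (A → ℕ) → ℕ
∑ xs f = sum (map f xs)

module _ {A : Set} where

  ∑-cong : ∀ (xs : List A) {f g} → f ≐ g → ∑ xs f ≡ ∑ xs g
  ∑-cong []       e = refl
  ∑-cong (x ∷ xs) e = cong₂ _+_ (e x) (∑-cong xs e)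

  ∑-0 : ∀ (xs : List A) → ∑ xs (λ _ → 0) ≡ 0
  ∑-0 []       = refl
  ∑-0 (x ∷ xs) = ∑-0 xs

  ∑-+ : ∀ (xs : List A) f g → ∑ xs (λ x → f x + g x) ≡ ∑ xs f + ∑ xs g
  ∑-+ []       f g = refl
  ∑-+ (x ∷ xs) f g rewrite ∑-+ xs f g =
    solve 4 (λ a b c d → (a :+ b) :+ (c :+ d) := (a :+ c) :+ (b :+ d)) refl (f x) (g x) (∑ xs f) (∑ xs g)
    where open +-*-Solver

  ∑-*ˡ : ∀ (xs : List A) k f → ∑ xs (λ x → k * f x) ≡ k * ∑ xs f
  ∑-*ˡ []       k f = sym (*-zeroʳ k)
  ∑-*ˡ (x ∷ xs) k f = trans (cong (k * f x +_) (∑-*ˡ xs k f)) (sym (*-distribˡ-+ k (f x) (∑ xs f)))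

  ∑-*ʳ : ∀ (xs : List A) f k → ∑ xs (λ x → f x * k) ≡ ∑ xs f * k
  ∑-*ʳ xs f k = trans (∑-cong xs (λ x → *-comm (f x) k)) (trans (∑-*ˡ xs k f) (*-comm k _))

  ∑-++ : ∀ (xs ys : List A) f → ∑ (xs ++ ys) f ≡ ∑ xs f + ∑ ys f
  ∑-++ []       ys f = refl
  ∑-++ (x ∷ xs) ys f = trans (cong (f x +_) (∑-++ xs ys f)) (sym (+-assoc (f x) _ _))

  count≡∑ : ∀ (xs : List A) p → count xs p ≡ ∑ xs (ind ∘ p)
  count≡∑ []       p = refl
  count≡∑ (x ∷ xs) p with p x
  ... | true  = cong suc (count≡∑ xs p)
  ... | false = count≡∑ xs p

module _ {A B : Set} where

  ∑-map : ∀ (h : A → B) xs f → ∑ (map h xs) f ≡ ∑ xs (f ∘ h)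
  ∑-map h []       f = refl
  ∑-map h (x ∷ xs) f = cong (f (h x) +_) (∑-map h xs f)

  ∑-concatMap : ∀ (h : A → List B) xs f → ∑ (concatMap h xs) f ≡ ∑ xs (λ x → ∑ (h x) f)
  ∑-concatMap h []       f = refl
  ∑-concatMap h (x ∷ xs) f = trans (∑-++ (h x) _ f) (cong (∑ (h x) f +_) (∑-concatMap h xs f))

module _ {A B : Set} where

  ∑-cartesianProduct : ∀ (xs : List A) (ys : List B) f →
    ∑ (cartesianProduct xs ys) f ≡ ∑ xs (λ x → ∑ ys (λ y → f (x , y)))
  ∑-cartesianProduct []       ys f = refl
  ∑-cartesianProduct (x ∷ xs) ys f =
    trans (∑-++ (map (x ,_) ys) _ f) (cong₂ _+_ (∑-map (x ,_) ys f) (∑-cartesianProduct xs ys f))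

  ∑-swap : ∀ (xs : List A) (ys : List B) (f : A → B → ℕ) → ∑ xs (λ x → ∑ ys (f x)) ≡ ∑ ys (λ y → ∑ xs (λ x → f x y))
  ∑-swap []       ys f = sym (∑-0 ys)
  ∑-swap (x ∷ xs) ys f =
    trans (cong (∑ ys (f x) +_) (∑-swap xs ys f)) (sym (∑-+ ys (f x) (λ y → ∑ xs (λ x′ → f x′ y))))

∑-allFin-suc : ∀ {n} (f : Fin (suc n) → ℕ) → ∑ (allFin (suc n)) f ≡ f zero + ∑ (allFin n) (f ∘ suc)
∑-allFin-suc f = cong (f zero +_) (cong sum (trans (map-tabulate suc f) (sym (map-tabulate id (f ∘ suc)))))

∑-≟ᵇ : ∀ {n} (x : Fin n) (f : Fin n → ℕ) → ∑ (allFin n) (λ y → ind (toℕ x ≡ᵇ toℕ y) * f y) ≡ f x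
∑-≟ᵇ {suc n} zero f = begin
  ∑ (allFin (suc n)) (λ y → ind (0 ≡ᵇ toℕ y) * f y) ≡⟨ ∑-allFin-suc (λ y → ind (0 ≡ᵇ toℕ y) * f y) ⟩
  f zero + 0 + ∑ (allFin n) (λ _ → 0)               ≡⟨ cong₂ _+_ (+-identityʳ _) (∑-0 (allFin n)) ⟩
  f zero + 0                                        ≡⟨ +-identityʳ _ ⟩
  f zero                                            ∎
  where open ≡-Reasoning
∑-≟ᵇ {suc n} (suc x) f =
  trans (∑-allFin-suc (λ y → ind (suc (toℕ x) ≡ᵇ toℕ y) * f y)) (∑-≟ᵇ x (f ∘ suc))

-- Enumerations of function spaces

-- The `cons` of `funs` is local to `Defs`, hence the existential.
funs-suc : ∀ a {B : Set} (bs : List B) → Σ (B → (Fin a → B) → Fin (suc a) → B) λ cons →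
  (∀ b f → cons b f zero ≡ b) × (∀ b f i → cons b f (suc i) ≡ f i) ×
  (funs (suc a) bs ≡ concatMap (λ b → map (cons b) (funs a bs)) bs)
funs-suc a bs = _ , (λ _ _ → refl) , (λ _ _ _ → refl) , refl

-- Unpacking `funs-suc` leaves the tail of `cons b f` equal to `f` only pointwise; this is why the
-- summand is replaced by an `h` that respects `≐`.
∑-funs-suc : ∀ a {B : Set} (bs : List B) {g : (Fin (suc a) → B) → ℕ} {h : B → (Fin a → B) → ℕ} →
  (∀ f → g f ≡ h (f zero) (f ∘ suc)) → (∀ b {f f′} → f ≐ f′ → h b f ≡ h b f′) →
  ∑ (funs (suc a) bs) g ≡ ∑ bs (λ b → ∑ (funs a bs) (h b))
∑-funs-suc a bs {g} {h} e h-cong with cons , c₀ , c₊ , p ← funs-suc a bs = begin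
  ∑ (funs (suc a) bs) g                                 ≡⟨ cong (λ xs → ∑ xs g) p ⟩
  ∑ (concatMap (λ b → map (cons b) (funs a bs)) bs) g   ≡⟨ ∑-concatMap _ bs g ⟩
  ∑ bs (λ b → ∑ (map (cons b) (funs a bs)) g)           ≡⟨ ∑-cong bs (λ b → ∑-map (cons b) (funs a bs) g) ⟩
  ∑ bs (λ b → ∑ (funs a bs) (g ∘ cons b))               ≡⟨ ∑-cong bs (λ b → ∑-cong (funs a bs) (step b)) ⟩
  ∑ bs (λ b → ∑ (funs a bs) (h b))                      ∎
  where
  open ≡-Reasoning
  step : ∀ b f → g (cons b f) ≡ h b f
  step b f = trans (e (cons b f)) (trans (cong (λ b′ → h b′ (cons b f ∘ suc)) (c₀ b f)) (h-cong b (c₊ b f)))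

allFinᵇ-cong : ∀ {n} {p q : Fin n → Bool} → p ≐ q → allFinᵇ p ≡ allFinᵇ q
allFinᵇ-cong {zero}  e = refl
allFinᵇ-cong {suc n} e = cong₂ _∧_ (e zero) (allFinᵇ-cong (e ∘ suc))

-- The indicator of a conjunction is a product, so the sum over functions factors into one sum per
-- argument, each equal to 1. In effect this is unique choice inside the list.
∑-funs-unique : ∀ a {B : Set} (bs : List B) (q : Fin a → B → Bool) →
  (∀ i → ∑ bs (ind ∘ q i) ≡ 1) → ∑ (funs a bs) (λ f → ind (allFinᵇ (λ i → q i (f i)))) ≡ 1
∑-funs-unique zero    bs q u = refl
∑-funs-unique (suc a) bs q u = begin
  ∑ (funs (suc a) bs) (λ f → ind (allFinᵇ (λ i → q i (f i))))
    ≡⟨ ∑-funs-suc a bs (λ f → ind-∧ (q zero (f zero)) _)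
         (λ b e → cong (λ z → ind (q zero b) * ind z) (allFinᵇ-cong (λ i → cong (q (suc i)) (e i)))) ⟩
  ∑ bs (λ b → ∑ (funs a bs) (λ f → ind (q zero b) * ind (allFinᵇ (λ i → q (suc i) (f i)))))
    ≡⟨ ∑-cong bs (λ b → trans (∑-*ˡ (funs a bs) (ind (q zero b)) _)
         (cong (ind (q zero b) *_) (∑-funs-unique a bs (q ∘ suc) (u ∘ suc)))) ⟩
  ∑ bs (λ b → ind (q zero b) * 1) ≡⟨ ∑-cong bs (λ b → *-identityʳ _) ⟩
  ∑ bs (ind ∘ q zero)             ≡⟨ u zero ⟩
  1                               ∎
  where open ≡-Reasoning

_≐ᵇ_ : ∀ {a k} → (Fin a → Fin k) → (Fin a → Fin k) → Bool
f ≐ᵇ g = allFinᵇ (λ i → toℕ (f i) ≡ᵇ toℕ (g i))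


T-≐ᵇ : ∀ {a k} {f g : Fin a → Fin k} → T (f ≐ᵇ g) ⇔ (f ≐ g)
T-≐ᵇ = mk⇔ (λ h i → toℕ-injective (≡ᵇ⇒≡ _ _ (to (T-allFinᵇ _) h i)))
           (λ e → from (T-allFinᵇ _) (λ i → ≡⇒≡ᵇ _ _ (cong toℕ (e i))))

∑-≐ᵇ : ∀ {a k} (f₀ : Fin a → Fin k) → ∑ (funs a (allFin k)) (λ f → ind (f₀ ≐ᵇ f)) ≡ 1
∑-≐ᵇ {a} {k} f₀ = ∑-funs-unique a (allFin k) (λ i b → toℕ (f₀ i) ≡ᵇ toℕ b)
  (λ i → trans (∑-cong (allFin k) (λ _ → sym (*-identityʳ _))) (∑-≟ᵇ (f₀ i) (λ _ → 1)))

-- Both sums count the pairs `(x , y)` of one common graph, once by `x` and once by `y`. Hypotheses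
-- about an arbitrary `y` with `f x ≐ y` avoid asking that the maps and predicates respect `≐`.
∑-bijection : ∀ {a k} (f g : (Fin a → Fin k) → (Fin a → Fin k)) (P Q : (Fin a → Fin k) → Bool) →
  (∀ {x y} → f x ≐ y → T (P x) → g y ≐ x × T (Q y)) →
  (∀ {x y} → g y ≐ x → T (Q y) → f x ≐ y × T (P x)) →
  ∑ (funs a (allFin k)) (ind ∘ P) ≡ ∑ (funs a (allFin k)) (ind ∘ Q)
∑-bijection {a} {k} f g P Q to′ from′ = begin
  ∑ F (ind ∘ P)                                        ≡⟨ ∑-cong F (λ x → expand (ind (P x)) (f x)) ⟩
  ∑ F (λ x → ∑ F (λ y → ind (f x ≐ᵇ y) * ind (P x)))   ≡⟨ ∑-swap F F _ ⟩
  ∑ F (λ y → ∑ F (λ x → ind (f x ≐ᵇ y) * ind (P x)))   ≡⟨ ∑-cong F (λ y → ∑-cong F (λ x → same x y)) ⟩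
  ∑ F (λ y → ∑ F (λ x → ind (g y ≐ᵇ x) * ind (Q y)))   ≡⟨ ∑-cong F (λ y → expand (ind (Q y)) (g y)) ⟨
  ∑ F (ind ∘ Q)                                        ∎
  where
  open ≡-Reasoning
  F = funs a (allFin k)
  expand : ∀ c f₀ → c ≡ ∑ F (λ f → ind (f₀ ≐ᵇ f) * c)
  expand c f₀ = sym (trans (∑-*ʳ F _ c) (trans (cong (_* c) (∑-≐ᵇ f₀)) (*-identityˡ c)))
  same : ∀ x y → ind (f x ≐ᵇ y) * ind (P x) ≡ ind (g y ≐ᵇ x) * ind (Q y)
  same x y = trans (sym (ind-∧ (f x ≐ᵇ y) (P x))) (trans (cong ind (T-ext
    (λ h → let e , p = to T-∧ h; e′ , q = to′ (to T-≐ᵇ e) p in from T-∧ (from T-≐ᵇ e′ , q))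
    (λ h → let e , q = to T-∧ h; e′ , p = from′ (to T-≐ᵇ e) q in from T-∧ (from T-≐ᵇ e′ , p))))
    (ind-∧ (g y ≐ᵇ x) (Q y)))

_≡ᴮ_ : Bool → Bool → Bool
a ≡ᴮ b = if a then b else not b

T-≡ᴮ : ∀ a b → T (a ≡ᴮ b) ⇔ (a ≡ b)
T-≡ᴮ false false = mk⇔ (λ _ → refl) _
T-≡ᴮ false true  = mk⇔ (λ ()) (λ ())
T-≡ᴮ true  false = mk⇔ (λ ()) (λ ())
T-≡ᴮ true  true  = mk⇔ (λ _ → refl) _

∑-≡ᴮ : ∀ a → ∑ (true ∷ false ∷ []) (λ b → ind (a ≡ᴮ b)) ≡ 1
∑-≡ᴮ false = refl
∑-≡ᴮ true  = refl

_≗ᵇ_ : ∀ {n} → Rel3 n → Rel3 n → Bool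
π ≗ᵇ ρ = allFinᵇ λ x → allFinᵇ λ y → allFinᵇ λ z → π x y z ≡ᴮ ρ x y z

T-≗ᵇ : ∀ {n} (π ρ : Rel3 n) → T (π ≗ᵇ ρ) ⇔ (∀ x y z → π x y z ≡ ρ x y z)
T-≗ᵇ π ρ = mk⇔
  (λ h x y z → to (T-≡ᴮ (π x y z) (ρ x y z))
    (to (T-allFinᵇ (q₃ x y)) (to (T-allFinᵇ (q₂ x)) (to (T-allFinᵇ q₁) h x) y) z))
  (λ e → from (T-allFinᵇ q₁) λ x → from (T-allFinᵇ (q₂ x)) λ y → from (T-allFinᵇ (q₃ x y)) λ z →
    from (T-≡ᴮ (π x y z) (ρ x y z)) (e x y z))
  where
  q₃ = λ x y z → π x y z ≡ᴮ ρ x y z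
  q₂ = λ x y → allFinᵇ (q₃ x y)
  q₁ = λ x → allFinᵇ (q₂ x)

∑-≗ᵇ : ∀ {n} (π : Rel3 n) → ∑ (allRel3 n) (λ ρ → ind (π ≗ᵇ ρ)) ≡ 1
∑-≗ᵇ {n} π =
  ∑-funs-unique (suc n) bs₂ (λ x ρ → allFinᵇ λ y → allFinᵇ λ z → π x y z ≡ᴮ ρ y z) λ x →
  ∑-funs-unique (suc n) bs₁ (λ y ρ → allFinᵇ λ z → π x y z ≡ᴮ ρ z) λ y →
  ∑-funs-unique (suc n) bs₀ (λ z b → π x y z ≡ᴮ b) λ z → ∑-≡ᴮ (π x y z)
  where
  bs₀ = true ∷ false ∷ []
  bs₁ = funs (suc n) bs₀
  bs₂ = funs (suc n) bs₁

-- Prefix sums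

-- On generating functions `S` is multiplication by 1/(1 - z), `shift d` is multiplication by z^d,
-- and `δ d` is the monomial z^d.
S : (ℕ → ℕ) → ℕ → ℕ
S h zero    = h 0
S h (suc t) = S h t + h (suc t)

S^ : ℕ → (ℕ → ℕ) → ℕ → ℕ
S^ zero    h = h
S^ (suc k) h = S (S^ k h)

S-cong : ∀ {h g} → h ≐ g → S h ≐ S g
S-cong e zero    = e 0
S-cong e (suc t) = cong₂ _+_ (S-cong e t) (e (suc t))

S^-cong : ∀ k {h g} → h ≐ g → S^ k h ≐ S^ k g
S^-cong zero    e = e
S^-cong (suc k) e = S-cong (S^-cong k e)

S-∑ : ∀ {A : Set} (xs : List A) (c : A → ℕ) (h : A → ℕ → ℕ) →
  S (λ t → ∑ xs (λ x → c x * h x t)) ≐ (λ t → ∑ xs (λ x → c x * S (h x) t))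
S-∑ xs c h zero    = refl
S-∑ xs c h (suc t) = begin
  S (λ t → ∑ xs (λ x → c x * h x t)) t + ∑ xs (λ x → c x * h x (suc t))
    ≡⟨ cong (_+ ∑ xs (λ x → c x * h x (suc t))) (S-∑ xs c h t) ⟩
  ∑ xs (λ x → c x * S (h x) t) + ∑ xs (λ x → c x * h x (suc t))
    ≡⟨ ∑-+ xs (λ x → c x * S (h x) t) (λ x → c x * h x (suc t)) ⟨
  ∑ xs (λ x → c x * S (h x) t + c x * h x (suc t))
    ≡⟨ ∑-cong xs (λ x → sym (*-distribˡ-+ (c x) (S (h x) t) (h x (suc t)))) ⟩
  ∑ xs (λ x → c x * S (h x) (suc t)) ∎
  where open ≡-Reasoning

S^-∑ : ∀ k {A : Set} (xs : List A) (c : A → ℕ) (h : A → ℕ → ℕ) →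
  S^ k (λ t → ∑ xs (λ x → c x * h x t)) ≐ (λ t → ∑ xs (λ x → c x * S^ k (h x) t))
S^-∑ zero    xs c h t = refl
S^-∑ (suc k) xs c h t = trans (S-cong (S^-∑ k xs c h) t) (S-∑ xs c (λ x → S^ k (h x)) t)

shift : ℕ → (ℕ → ℕ) → ℕ → ℕ
shift zero    h u       = h u
shift (suc d) h zero    = 0
shift (suc d) h (suc u) = shift d h u

shift-+ : ∀ a d h u → shift (a + d) h (a + u) ≡ shift d h u
shift-+ zero    d h u = refl
shift-+ (suc a) d h u = shift-+ a d h u

S-shift-suc : ∀ d h u → S (shift (suc d) h) (suc u) ≡ S (shift d h) u
S-shift-suc d h zero    = refl
S-shift-suc d h (suc u) = cong (_+ shift d h (suc u)) (S-shift-suc d h u)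

S-shift : ∀ d h → S (shift d h) ≐ shift d (S h)
S-shift zero    h u       = refl
S-shift (suc d) h zero    = refl
S-shift (suc d) h (suc u) = trans (S-shift-suc d h u) (S-shift d h u)

S^-shift : ∀ k d h → S^ k (shift d h) ≐ shift d (S^ k h)
S^-shift zero    d h u = refl
S^-shift (suc k) d h u = trans (S-cong (S^-shift k d h) u) (S-shift d (S^ k h) u)

δ : ℕ → ℕ → ℕ
δ d m = ind (d ≡ᵇ m)

δ-+ : ∀ a d → δ (a + d) ≐ shift a (δ d)
δ-+ zero    d m       = refl
δ-+ (suc a) d zero    = refl
δ-+ (suc a) d (suc m) = δ-+ a d m

-- Reverse the summation by u = t - b: u runs over 0,...,t - a, which is a prefix sum at t - a. For
-- a > t no `b` remains, in agreement with the value 0 of `shift`.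
∑-≤ᵇ : ∀ t a h → ∑ (allFin (suc t)) (λ b → ind (a ≤ᵇ toℕ b) * h (t ∸ toℕ b)) ≡ shift a (S h) t
∑-≤ᵇ zero    zero    h = trans (+-identityʳ _) (+-identityʳ _)
∑-≤ᵇ zero    (suc a) h = refl
∑-≤ᵇ (suc t) zero    h = begin
  ∑ (allFin (suc (suc t))) (λ b → 1 * h (suc t ∸ toℕ b)) ≡⟨ ∑-allFin-suc {suc t} (λ b → 1 * h (suc t ∸ toℕ b)) ⟩
  h (suc t) + 0 + ∑ (allFin (suc t)) (λ b → 1 * h (t ∸ toℕ b)) ≡⟨ cong₂ _+_ (+-identityʳ _) (∑-≤ᵇ t zero h) ⟩
  h (suc t) + S h t ≡⟨ +-comm (h (suc t)) (S h t) ⟩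
  S h (suc t) ∎
  where open ≡-Reasoning
∑-≤ᵇ (suc t) (suc a) h =
  trans (∑-allFin-suc {suc t} (λ b → ind (suc a ≤ᵇ toℕ b) * h (suc t ∸ toℕ b)))
 (trans (∑-cong (allFin (suc t)) (λ b → cong (λ z → ind z * h (t ∸ toℕ b)) (≤ᵇ-suc a (toℕ b))))
        (∑-≤ᵇ t a h))
  where
  ≤ᵇ-suc : ∀ a b → (suc a ≤ᵇ suc b) ≡ (a ≤ᵇ b)
  ≤ᵇ-suc zero    b = refl
  ≤ᵇ-suc (suc a) b = refl

climbs : ∀ {n t} → ℕ → (Fin n → ℕ) → (Fin n → Fin t) → Bool
climbs {zero}  lo d c = true
climbs {suc n} lo d c = (lo + d zero ≤ᵇ toℕ (c zero)) ∧ climbs (toℕ (c zero)) (d ∘ suc) (c ∘ suc)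

climbs-cong : ∀ {n t} lo (d : Fin n → ℕ) {c c′ : Fin n → Fin t} → c ≐ c′ → climbs lo d c ≡ climbs lo d c′
climbs-cong {zero}  lo d e = refl
climbs-cong {suc n} lo d {c} {c′} e rewrite e zero =
  cong (_ ∧_) (climbs-cong (toℕ (c′ zero)) (d ∘ suc) (e ∘ suc))

-- `u` is the room left above the current value `lo`. Summing over the first entry adds a factor
-- 1/(1 - z), and its forced rise a factor z^(d zero); the empty sequence, one for every room, is
-- the initial 1/(1 - z). Hence n + 1 prefix sums for n entries.
∑-climbs : ∀ n {t lo} u (d : Fin n → ℕ) → lo + u ≡ t →
  ∑ (funs n (allFin (suc t))) (ind ∘ climbs lo d) ≡ S^ (suc n) (δ (∑ (allFin n) d)) u
∑-climbs zero    u d e = S-δ u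
  where
  S-δ : ∀ u → 1 ≡ S (δ 0) u
  S-δ zero    = refl
  S-δ (suc u) = trans (S-δ u) (sym (+-identityʳ _))
∑-climbs (suc n) {t} {lo} u d refl = begin
  ∑ (funs (suc n) F) (ind ∘ climbs lo d)
    ≡⟨ ∑-funs-suc n F (λ c → ind-∧ (lo + d zero ≤ᵇ toℕ (c zero)) _)
         (λ b e → cong (λ z → ind (lo + d zero ≤ᵇ toℕ b) * ind z) (climbs-cong (toℕ b) (d ∘ suc) e)) ⟩
  ∑ F (λ b → ∑ (funs n F) (λ c → ind (lo + d zero ≤ᵇ toℕ b) * ind (climbs (toℕ b) (d ∘ suc) c)))
    ≡⟨ ∑-cong F (λ b → trans (∑-*ˡ (funs n F) (ind (lo + d zero ≤ᵇ toℕ b)) _)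
         (cong (ind (lo + d zero ≤ᵇ toℕ b) *_)
           (∑-climbs n (t ∸ toℕ b) (d ∘ suc) (m+[n∸m]≡n (toℕ≤pred[n] b))))) ⟩
  ∑ F (λ b → ind (lo + d zero ≤ᵇ toℕ b) * S^ (suc n) (δ D) (t ∸ toℕ b))
    ≡⟨ ∑-≤ᵇ t (lo + d zero) (S^ (suc n) (δ D)) ⟩
  -- `t` is `lo + u`, so `lo` cancels and the count depends on the room alone.
  shift (lo + d zero) (S^ (2 + n) (δ D)) (lo + u)
    ≡⟨ shift-+ lo (d zero) (S^ (2 + n) (δ D)) u ⟩
  shift (d zero) (S^ (2 + n) (δ D)) u
    ≡⟨ S^-shift (2 + n) (d zero) (δ D) u ⟨
  S^ (2 + n) (shift (d zero) (δ D)) u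
    ≡⟨ S^-cong (2 + n) (δ-+ (d zero) D) u ⟨
  S^ (2 + n) (δ (d zero + D)) u
    ≡⟨ cong (λ z → S^ (2 + n) (δ z) u) (∑-allFin-suc d) ⟨
  S^ (2 + n) (δ (∑ (allFin (suc n)) d)) u ∎
  where
  open ≡-Reasoning
  F = allFin (suc t)
  D = ∑ (allFin n) (d ∘ suc)

-- The h*-transform

∑ℤ : ℕ → (ℕ → ℤ.ℤ) → ℤ.ℤ
∑ℤ zero    f = ℤ.+ 0
∑ℤ (suc m) f = f 0 ℤ.+ ∑ℤ m (f ∘ suc)

∑ℤ-cong : ∀ m {f g} → f ≐ g → ∑ℤ m f ≡ ∑ℤ m g
∑ℤ-cong zero    e = refl
∑ℤ-cong (suc m) e = cong₂ ℤ._+_ (e 0) (∑ℤ-cong m (e ∘ suc))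

∑ℤ-0 : ∀ m → ∑ℤ m (λ _ → ℤ.+ 0) ≡ ℤ.+ 0
∑ℤ-0 zero    = refl
∑ℤ-0 (suc m) = trans (ℤ.+-identityˡ _) (∑ℤ-0 m)

∑ℤ-minus : ∀ m f g → ∑ℤ m (λ j → f j ℤ.- g j) ≡ ∑ℤ m f ℤ.- ∑ℤ m g
∑ℤ-minus zero    f g = refl
∑ℤ-minus (suc m) f g = trans (cong (λ z → (f 0 ℤ.- g 0) ℤ.+ z) (∑ℤ-minus m (f ∘ suc) (g ∘ suc)))
  (solve 4 (λ a b c d → (a :- b) :+ (c :- d) := (a :+ c) :- (b :+ d)) refl (f 0) (g 0) _ _)
  where open ℤ-Solver

term : ℕ → (ℕ → ℕ) → ℕ → ℕ → ℤ.ℤ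
term N E m j = sign j ℤ.* ℤ.+ (binom N j * E (m ∸ j))

-- The coefficients of (1 - z)^N times the generating function of `E`. Freeing `N` from the
-- dimension makes induction on it possible.
differences : ℕ → (ℕ → ℕ) → ℕ → ℤ.ℤ
differences N E m = ∑ℤ (suc m) (term N E m)

hstarCoeff≡differences : ∀ n E m → hstarCoeff n E m ≡ differences (suc n) E m
hstarCoeff≡differences n E m = foldr-map (suc m) id
  where
  foldr-map : ∀ k (h : ℕ → ℕ) → foldr ℤ._+_ (ℤ.+ 0) (map (term (suc n) E m) (applyUpTo h k)) ≡ ∑ℤ k (term (suc n) E m ∘ h)
  foldr-map zero    h = refl
  foldr-map (suc k) h = cong (λ z → term (suc n) E m (h 0) ℤ.+ z) (foldr-map k (h ∘ suc))

differences-cong : ∀ N {E F} → E ≐ F → differences N E ≐ differences N F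
differences-cong N e m = ∑ℤ-cong (suc m) (λ j → cong (λ z → sign j ℤ.* ℤ.+ (binom N j * z)) (e (m ∸ j)))

differences-0 : ∀ E m → differences 0 E m ≡ ℤ.+ (E m)
differences-0 E m = begin
  ℤ.+ 1 ℤ.* ℤ.+ (1 * E m) ℤ.+ ∑ℤ m (λ j → sign (suc j) ℤ.* ℤ.+ 0)
    ≡⟨ cong₂ ℤ._+_ (trans (ℤ.*-identityˡ _) (cong ℤ.+_ (*-identityˡ (E m))))
         (trans (∑ℤ-cong m (λ j → ℤ.*-zeroʳ (sign (suc j)))) (∑ℤ-0 m)) ⟩
  ℤ.+ (E m) ℤ.+ ℤ.+ 0 ≡⟨ ℤ.+-identityʳ _ ⟩
  ℤ.+ (E m) ∎
  where open ≡-Reasoning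

-- By Pascal's rule, raising N by one multiplies the generating function by 1 - z.
differences-pascal : ∀ N E m → differences (suc N) E (suc m) ≡ differences N E (suc m) ℤ.- differences N E m
differences-pascal N E m = begin
  term (suc N) E (suc m) 0 ℤ.+ ∑ℤ (suc m) (λ j → term (suc N) E (suc m) (suc j))
    ≡⟨ cong (λ z → term N E (suc m) 0 ℤ.+ z) (∑ℤ-cong (suc m) pascal) ⟩
  term N E (suc m) 0 ℤ.+ ∑ℤ (suc m) (λ j → term N E (suc m) (suc j) ℤ.- term N E m j)
    ≡⟨ cong (λ z → term N E (suc m) 0 ℤ.+ z) (∑ℤ-minus (suc m) (λ j → term N E (suc m) (suc j)) (term N E m)) ⟩
  term N E (suc m) 0 ℤ.+ (∑ℤ (suc m) (λ j → term N E (suc m) (suc j)) ℤ.- differences N E m)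
    ≡⟨ ℤ.+-assoc (term N E (suc m) 0) _ _ ⟨
  differences N E (suc m) ℤ.- differences N E m ∎
  where
  open ≡-Reasoning
  pascal : ∀ j → term (suc N) E (suc m) (suc j) ≡ term N E (suc m) (suc j) ℤ.- term N E m j
  pascal j = begin
    (ℤ.- sign j) ℤ.* ℤ.+ ((binom N j + binom N (suc j)) * E (m ∸ j))
      ≡⟨ cong (λ z → (ℤ.- sign j) ℤ.* ℤ.+ z) (*-distribʳ-+ (E (m ∸ j)) (binom N j) (binom N (suc j))) ⟩
    (ℤ.- sign j) ℤ.* (ℤ.+ (binom N j * E (m ∸ j)) ℤ.+ ℤ.+ (binom N (suc j) * E (m ∸ j)))
      ≡⟨ solve 3 (λ s a b → (:- s) :* (a :+ b) := (:- s) :* b :- s :* a) refl (sign j) (ℤ.+ (binom N j * E (m ∸ j))) _ ⟩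
    term N E (suc m) (suc j) ℤ.- term N E m j ∎
    where open ℤ-Solver

differences-at-0 : ∀ N E → differences N E 0 ≡ ℤ.+ (E 0)
differences-at-0 N E = trans (ℤ.+-identityʳ _) (trans (ℤ.*-identityˡ _) (cong ℤ.+_ (*-identityˡ (E 0))))

-- 1 - z cancels 1/(1 - z). Pascal's rule lowers `N` until `N = 0`, where S h (m + 1) - S h m
-- telescopes; index 0 is separate because the rule relates m + 1 to m.
differences-S : ∀ N h → differences (suc N) (S h) ≐ differences N h
differences-S N h zero = trans (differences-at-0 (suc N) (S h)) (sym (differences-at-0 N h))
differences-S zero h (suc m) = begin
  differences 1 (S h) (suc m)                             ≡⟨ differences-pascal 0 (S h) m ⟩
  differences 0 (S h) (suc m) ℤ.- differences 0 (S h) m   ≡⟨ cong₂ ℤ._-_ (differences-0 (S h) (suc m)) (differences-0 (S h) m) ⟩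
  ℤ.+ S h m ℤ.+ ℤ.+ h (suc m) ℤ.- ℤ.+ S h m               ≡⟨ solve 2 (λ a b → a :+ b :- a := b) refl (ℤ.+ S h m) (ℤ.+ h (suc m)) ⟩
  ℤ.+ h (suc m)                                           ≡⟨ differences-0 h (suc m) ⟨
  differences 0 h (suc m)                                 ∎
  where
  open ≡-Reasoning
  open ℤ-Solver
differences-S (suc N) h (suc m) = begin
  differences (2 + N) (S h) (suc m)
    ≡⟨ differences-pascal (suc N) (S h) m ⟩
  differences (suc N) (S h) (suc m) ℤ.- differences (suc N) (S h) m
    ≡⟨ cong₂ ℤ._-_ (differences-S N h (suc m)) (differences-S N h m) ⟩
  differences N h (suc m) ℤ.- differences N h m
    ≡⟨ differences-pascal N h m ⟨
  differences (suc N) h (suc m) ∎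
  where open ≡-Reasoning

differences-S^ : ∀ N h m → differences N (S^ N h) m ≡ ℤ.+ (h m)
differences-S^ zero    h m = differences-0 h m
differences-S^ (suc N) h m = trans (differences-S N (S^ N h) m) (differences-S^ N h m)

-- Finite linear orders

adjacent : ∀ {n} {k k′ : Fin (suc n)} → toℕ k′ ≡ suc (toℕ k) → ∃ λ l → k ≡ inject₁ l × k′ ≡ suc l
adjacent {k = k} {suc l} e = l , toℕ-injective (trans (sym (suc-injective e)) (sym (toℕ-inject₁ l))) , refl

T-adjacent : ∀ {n} (l : Fin n) → T (toℕ (suc l) ≡ᵇ suc (toℕ (inject₁ l)))
T-adjacent l = ≡⇒≡ᵇ _ _ (cong suc (sym (toℕ-inject₁ l)))

strictlyMonotone : ∀ {n} (f : Fin (suc n) → ℕ) → (∀ l → f (inject₁ l) < f (suc l)) →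
  ∀ a b → toℕ a < toℕ b → f a < f b
strictlyMonotone {suc n} f h zero    (suc zero)    _ = h zero
strictlyMonotone {suc n} f h zero    (suc (suc b)) _ =
  <-trans (h zero) (strictlyMonotone (f ∘ suc) (h ∘ suc) zero (suc b) z<s)
strictlyMonotone {suc n} f h (suc a) (suc b)       (s≤s a<b) = strictlyMonotone (f ∘ suc) (h ∘ suc) a b a<b

strictlyMonotone-reflects : ∀ {n} (f : Fin (suc n) → ℕ) → (∀ l → f (inject₁ l) < f (suc l)) →
  ∀ a b → f a < f b → toℕ a < toℕ b
strictlyMonotone-reflects f h a b fa<fb with <-cmp (toℕ a) (toℕ b)
... | tri< a<b _ _ = a<b
... | tri≈ _ a≡b _ = contradiction (subst (λ z → f z < f b) (toℕ-injective a≡b) fa<fb) (<-irrefl refl)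
... | tri> _ _ b<a = contradiction (strictlyMonotone f h b a b<a) (<-asym fa<fb)

-- Consecutive values differ by at least one, so the graph never drops below the diagonal.
strictlyMonotone-expands : ∀ {n m} (f : Fin n → Fin m) → (∀ a b → toℕ a < toℕ b → toℕ (f a) < toℕ (f b)) →
  ∀ a → toℕ a ≤ toℕ (f a)
strictlyMonotone-expands f h zero    = z≤n
strictlyMonotone-expands {suc (suc n)} f h (suc a) = begin-strict
  -- Dropping the last point, not the first, keeps the labels: `inject₁ a` still has index `toℕ a`.
  toℕ a                ≤⟨ strictlyMonotone-expands (f ∘ inject₁) (λ x y x<y → h _ _
                            (subst₂ _<_ (sym (toℕ-inject₁ x)) (sym (toℕ-inject₁ y)) x<y)) a ⟩
  toℕ (f (inject₁ a))  <⟨ h (inject₁ a) (suc a) (s≤s (≤-reflexive (toℕ-inject₁ a))) ⟩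
  toℕ (f (suc a))      ∎
  where open ≤-Reasoning

Inj : ∀ {A B : Set} → (A → B) → Set
Inj f = ∀ {x y} → f x ≡ f y → x ≡ y

-- Pigeonhole: an omitted value could be punched out, giving an injection into a set with one
-- element fewer.
injective⇒surjective : ∀ {n} (w : Fin (suc n) → Fin (suc n)) → Inj w → ∀ y → ∃ λ x → w x ≡ y
injective⇒surjective w inj y with any? (λ x → w x ≟ y)
... | yes x = x
... | no ∄x = contradiction
  (injective⇒≤ {f = λ x → punchOut (y≢ x)} (λ {x} {x′} e → inj (punchOut-injective (y≢ x) (y≢ x′) e))) 1+n≰n
  where
  y≢ : ∀ x → y ≢ w x
  y≢ x e = ∄x (x , sym e)

Sorts : ∀ {n} → (Fin (suc n) → ℕ) → (Fin (suc n) → Fin (suc n)) → Set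
Sorts κ w = ∀ l → κ (w (inject₁ l)) < κ (w (suc l))

minimum : ∀ {n} (κ : Fin (suc n) → ℕ) → ∃ λ m → ∀ x → κ m ≤ κ x
minimum {zero}  κ = zero , λ { zero → ≤-refl }
minimum {suc n} κ with m , h ← minimum (κ ∘ suc) with ≤-total (κ zero) (κ (suc m))
... | inj₁ p = zero  , λ { zero → ≤-refl ; (suc x) → ≤-trans p (h x) }
... | inj₂ p = suc m , λ { zero → p ; (suc x) → h x }

-- Selection sort: the minimum comes first, and the remaining points, renumbered by `punchIn`, are
-- sorted recursively. Injectivity of the key makes the order strict.
sorting : ∀ {n} (κ : Fin (suc n) → ℕ) → Inj κ → ∃ (Sorts κ)
sorting {zero}  κ inj = id , λ ()
sorting {suc n} κ inj with m , min ← minimum κ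
  with w , h ← sorting (κ ∘ punchIn m) (λ e → punchIn-injective m _ _ (inj e)) = w′ , h′
  where
  w′ : Fin (suc (suc n)) → Fin (suc (suc n))
  w′ zero    = m
  w′ (suc x) = punchIn m (w x)
  h′ : Sorts κ w′
  h′ zero    = ≤∧≢⇒< (min _) (λ e → punchInᵢ≢i m _ (sym (inj e)))
  h′ (suc l) = h l

sorts⇒injective : ∀ {n} (κ : Fin (suc n) → ℕ) w → Sorts κ w → Inj w
sorts⇒injective κ w s {x} {y} e with <-cmp (toℕ x) (toℕ y)
... | tri< p _ _ = contradiction (strictlyMonotone (κ ∘ w) s x y p) (<-irrefl (cong κ e))
... | tri≈ _ p _ = toℕ-injective p
... | tri> _ _ p = contradiction (strictlyMonotone (κ ∘ w) s y x p) (<-irrefl (cong κ (sym e)))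

-- The transition map from positions in `v` to positions in `w` is strictly increasing, and so is
-- its inverse. Neither drops below the diagonal, so both are the identity.
sorts-unique : ∀ {n} (κ : Fin (suc n) → ℕ) v w → Sorts κ v → Sorts κ w → v ≐ w
sorts-unique κ v w sv sw a = trans (sym (proj₂ (f a))) (cong w (toℕ-injective (≤-antisym fa≤a (expands v w sv sw a))))
  where
  transition : ∀ v w → Sorts κ w → ∀ a → ∃ λ b → w b ≡ v a
  transition v w sw a = injective⇒surjective w (sorts⇒injective κ w sw) (v a)
  expands : ∀ v w → Sorts κ v → (sw : Sorts κ w) → ∀ a → toℕ a ≤ toℕ (proj₁ (transition v w sw a))
  expands v w sv sw = strictlyMonotone-expands (λ a → proj₁ (transition v w sw a))
    (λ a b a<b → strictlyMonotone-reflects (κ ∘ w) sw _ _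
      (subst₂ (λ x y → κ x < κ y) (sym (proj₂ (transition v w sw a))) (sym (proj₂ (transition v w sw b)))
        (strictlyMonotone (κ ∘ v) sv a b a<b)))
  f = transition v w sw
  fa≤a : toℕ (proj₁ (f a)) ≤ toℕ a
  -- The inverse transition, applied at `f a`, returns to `a`; its expansion gives the opposite
  -- inequality.
  fa≤a = subst (λ b → toℕ (proj₁ (f a)) ≤ toℕ b)
    (sorts⇒injective κ v sv (trans (proj₂ (transition w v sv (proj₁ (f a)))) (proj₂ (f a))))
    (expands w v sw sv (proj₁ (f a)))

-- Cyclic orders

Cyc : ℕ → ℕ → ℕ → Set
Cyc a b c = (a < b × b < c) ⊎ (b < c × c < a) ⊎ (c < a × a < b)

cycᵇ : ℕ → ℕ → ℕ → Bool
cycᵇ a b c = (a <ᵇ b) ∧ (b <ᵇ c) ∨ (b <ᵇ c) ∧ (c <ᵇ a) ∨ (c <ᵇ a) ∧ (a <ᵇ b)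

T-< : ∀ {m n} → T (m <ᵇ n) ⇔ m < n
T-< {m} {n} = mk⇔ (<ᵇ⇒< m n) <⇒<ᵇ

T-cycᵇ : ∀ a b c → T (cycᵇ a b c) ⇔ Cyc a b c
T-cycᵇ a b c = mk⇔ f g
  where
  both : ∀ {i j k l} → T ((i <ᵇ j) ∧ (k <ᵇ l)) → i < j × k < l
  both h = let p , q = to T-∧ h in to T-< p , to T-< q
  both⁻ : ∀ {i j k l} → i < j × k < l → T ((i <ᵇ j) ∧ (k <ᵇ l))
  both⁻ (p , q) = from T-∧ (from T-< p , from T-< q)
  f : T (cycᵇ a b c) → Cyc a b c
  f h with to (T-∨ {(a <ᵇ b) ∧ (b <ᵇ c)}) h
  ... | inj₁ p = inj₁ (both {a} {b} p)
  ... | inj₂ h′ with to (T-∨ {(b <ᵇ c) ∧ (c <ᵇ a)}) h′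
  ...   | inj₁ p = inj₂ (inj₁ (both {b} {c} p))
  ...   | inj₂ p = inj₂ (inj₂ (both {c} {a} p))
  g : Cyc a b c → T (cycᵇ a b c)
  g (inj₁ p)        = from (T-∨ {(a <ᵇ b) ∧ (b <ᵇ c)}) (inj₁ (both⁻ p))
  g (inj₂ (inj₁ p)) = from (T-∨ {(a <ᵇ b) ∧ (b <ᵇ c)}) (inj₂ (from (T-∨ {(b <ᵇ c) ∧ (c <ᵇ a)}) (inj₁ (both⁻ p))))
  g (inj₂ (inj₂ p)) = from (T-∨ {(a <ᵇ b) ∧ (b <ᵇ c)}) (inj₂ (from (T-∨ {(b <ᵇ c) ∧ (c <ᵇ a)}) (inj₂ (both⁻ p))))

Cyc-rotate : ∀ {a b c} → Cyc a b c → Cyc b c a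
Cyc-rotate (inj₁ p)        = inj₂ (inj₂ p)
Cyc-rotate (inj₂ (inj₁ p)) = inj₁ p
Cyc-rotate (inj₂ (inj₂ p)) = inj₂ (inj₁ p)

Cyc-asym : ∀ {a b c} → Cyc a b c → ¬ Cyc c b a
Cyc-asym (inj₁ (p , q))        (inj₁ (r , s))        = <-asym p s
Cyc-asym (inj₁ (p , q))        (inj₂ (inj₁ (r , s))) = <-asym p r
Cyc-asym (inj₁ (p , q))        (inj₂ (inj₂ (r , s))) = <-asym q s
Cyc-asym (inj₂ (inj₁ (p , q))) (inj₁ (r , s))        = <-asym p r
Cyc-asym (inj₂ (inj₁ (p , q))) (inj₂ (inj₁ (r , s))) = <-asym q s
Cyc-asym (inj₂ (inj₁ (p , q))) (inj₂ (inj₂ (r , s))) = <-asym p s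
Cyc-asym (inj₂ (inj₂ (p , q))) (inj₁ (r , s))        = <-asym q s
Cyc-asym (inj₂ (inj₂ (p , q))) (inj₂ (inj₁ (r , s))) = <-asym p s
Cyc-asym (inj₂ (inj₂ (p , q))) (inj₂ (inj₂ (r , s))) = <-asym p r

Cyc-trans : ∀ {a b c d} → Cyc a b c → Cyc a c d → Cyc a b d
Cyc-trans (inj₁ (p , q))        (inj₁ (r , s))        = inj₁ (p , <-trans q s)
Cyc-trans (inj₁ (p , q))        (inj₂ (inj₁ (r , s))) = inj₂ (inj₂ (s , p))
Cyc-trans (inj₁ (p , q))        (inj₂ (inj₂ (r , s))) = inj₂ (inj₂ (r , p))
Cyc-trans (inj₂ (inj₁ (p , q))) (inj₁ (r , s))        = ⊥-elim (<-asym q r)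
Cyc-trans (inj₂ (inj₁ (p , q))) (inj₂ (inj₁ (r , s))) = inj₂ (inj₁ (<-trans p r , s))
Cyc-trans (inj₂ (inj₁ (p , q))) (inj₂ (inj₂ (r , s))) = ⊥-elim (<-asym q s)
Cyc-trans (inj₂ (inj₂ (p , q))) (inj₁ (r , s))        = ⊥-elim (<-asym p r)
Cyc-trans (inj₂ (inj₂ (p , q))) (inj₂ (inj₁ (r , s))) = inj₂ (inj₂ (s , q))
Cyc-trans (inj₂ (inj₂ (p , q))) (inj₂ (inj₂ (r , s))) = ⊥-elim (<-asym p s)

Cyc-total : ∀ {a b c} → a ≢ b → b ≢ c → a ≢ c → Cyc a b c ⊎ Cyc c b a
Cyc-total {a} {b} {c} a≢b b≢c a≢c with <-cmp a b | <-cmp b c | <-cmp a c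
... | tri≈ _ e _ | _          | _          = contradiction e a≢b
... | _          | tri≈ _ e _ | _          = contradiction e b≢c
... | _          | _          | tri≈ _ e _ = contradiction e a≢c
... | tri< p _ _ | tri< q _ _ | _          = inj₁ (inj₁ (p , q))
... | tri< p _ _ | tri> _ _ q | tri< r _ _ = inj₂ (inj₂ (inj₂ (r , q)))
... | tri< p _ _ | tri> _ _ q | tri> _ _ r = inj₁ (inj₂ (inj₂ (r , p)))
... | tri> _ _ p | tri< q _ _ | tri< r _ _ = inj₂ (inj₂ (inj₁ (p , r)))
... | tri> _ _ p | tri< q _ _ | tri> _ _ r = inj₁ (inj₂ (inj₁ (q , r)))
... | tri> _ _ p | tri> _ _ q | _          = inj₂ (inj₁ (q , p))

record TotalCyclicOrder {n} (π : Rel3 n) : Set where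
  field
    rotate : ∀ {x y z} → T (π x y z) → T (π y z x)
    asym   : ∀ {x y z} → T (π x y z) → ¬ T (π z y x)
    transit : ∀ {x y z u} → T (π x y z) → T (π x z u) → T (π x y u)
    total  : ∀ {x y z} → x ≢ y → y ≢ z → x ≢ z → T (π x y z) ⊎ T (π z y x)

T-not : ∀ {b} → T (not b) ⇔ (¬ T b)
T-not {false} = mk⇔ (λ _ ()) _
T-not {true}  = mk⇔ (λ ()) (λ f → f _)

T-≟ᵇ : ∀ {n} {x y : Pt n} → T (x ≟ᵇ y) ⇔ x ≡ y
T-≟ᵇ = mk⇔ (λ h → toℕ-injective (≡ᵇ⇒≡ _ _ h)) (λ e → ≡⇒≡ᵇ _ _ (cong toℕ e))

T-isTotalCyclicOrder : ∀ {n} (π : Rel3 n) → T (isTotalCyclicOrder n π) ⇔ TotalCyclicOrder π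
T-isTotalCyclicOrder {n} π = mk⇔ f g
  where
  p₁ p₂ p₄ p : Pt n → Pt n → Pt n → Bool
  p₃ : Pt n → Pt n → Pt n → Pt n → Bool
  p₁ x y z = π x y z ⇒ᵇ π y z x
  p₂ x y z = π x y z ⇒ᵇ not (π z y x)
  p₃ x y z u = (π x y z ∧ π x z u) ⇒ᵇ π x y u
  p₄ x y z = (not (x ≟ᵇ y) ∧ not (y ≟ᵇ z) ∧ not (x ≟ᵇ z)) ⇒ᵇ (π x y z ∨ π z y x)
  p x y z = p₁ x y z ∧ p₂ x y z ∧ allᵇ (pts n) (p₃ x y z) ∧ p₄ x y z
  f : T (isTotalCyclicOrder n π) → TotalCyclicOrder π
  f h = record
    { rotate  = λ {x} {y} {z} → to T-⇒ (proj₁ (at x y z))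
    ; asym    = λ {x} {y} {z} q → to T-not (to (T-⇒ {π x y z}) (proj₁ (to T-∧ (proj₂ (at x y z)))) q)
    ; transit = λ {x} {y} {z} {u} q r →
        to (T-⇒ {π x y z ∧ π x z u})
           (to (T-all (p₃ x y z)) (proj₁ (to (T-∧ {allᵇ (pts n) (p₃ x y z)}) (proj₂ (to (T-∧ {p₂ x y z}) (proj₂ (at x y z)))))) u)
           (from T-∧ (q , r))
    ; total   = λ {x} {y} {z} x≢y y≢z x≢z →
        to T-∨ (to (T-⇒ {not (x ≟ᵇ y) ∧ not (y ≟ᵇ z) ∧ not (x ≟ᵇ z)})
          (proj₂ (to (T-∧ {allᵇ (pts n) (p₃ x y z)}) (proj₂ (to (T-∧ {p₂ x y z}) (proj₂ (at x y z))))))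
          (from T-∧ (from T-not (x≢y ∘ to (T-≟ᵇ {x = x})) ,
            from T-∧ (from T-not (y≢z ∘ to (T-≟ᵇ {x = y})) , from T-not (x≢z ∘ to (T-≟ᵇ {x = x}))))))
    }
    where
    at : ∀ x y z → T (p₁ x y z) × T (p₂ x y z ∧ allᵇ (pts n) (p₃ x y z) ∧ p₄ x y z)
    at x y z = to (T-∧ {p₁ x y z}) (to (T-all (p x y))
      (to (T-all (λ y → allᵇ (pts n) (p x y))) (to (T-all (λ x → allᵇ (pts n) λ y → allᵇ (pts n) (p x y))) h x) y) z)
  g : TotalCyclicOrder π → T (isTotalCyclicOrder n π)
  g o = from (T-all (λ x → allᵇ (pts n) λ y → allᵇ (pts n) (p x y))) λ x →
        from (T-all (λ y → allᵇ (pts n) (p x y))) λ y → from (T-all (p x y)) λ z →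
        from (T-∧ {p₁ x y z}) (from T-⇒ rotate ,
        from (T-∧ {p₂ x y z}) (from (T-⇒ {π x y z}) (λ q → from T-not (asym q)) ,
        from (T-∧ {allᵇ (pts n) (p₃ x y z)})
          (from (T-all (p₃ x y z)) (λ u → from (T-⇒ {π x y z ∧ π x z u}) (λ h → let q , r = to T-∧ h in transit q r)) ,
        from (T-⇒ {not (x ≟ᵇ y) ∧ not (y ≟ᵇ z) ∧ not (x ≟ᵇ z)}) (λ h →
          let x≢y , h′ = to (T-∧ {not (x ≟ᵇ y)}) h; y≢z , x≢z = to (T-∧ {not (y ≟ᵇ z)}) h′ in
          from T-∨ (total (to T-not x≢y ∘ from T-≟ᵇ) (to T-not y≢z ∘ from T-≟ᵇ) (to T-not x≢z ∘ from T-≟ᵇ))))))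
    where open TotalCyclicOrder o

record Underline {n} (π : Rel3 n) (w : Word n) : Set where
  field
    starts    : w zero ≡ zero
    injective : Inj w
    chain     : ∀ l → 0 < toℕ (inject₁ l) → T (π (w zero) (w (inject₁ l)) (w (suc l)))

T-≤ : ∀ {m n} → T (m ≤ᵇ n) ⇔ m ≤ n
T-≤ {m} {n} = mk⇔ (≤ᵇ⇒≤ m n) ≤⇒≤ᵇ

T-isUnderline : ∀ {n} (π : Rel3 n) w → T (isUnderline n π w) ⇔ Underline π w
T-isUnderline {n} π w = mk⇔ f g
  where
  p₁ p₂ : Pt n → Pt n → Bool
  p₁ a b = (w a ≟ᵇ w b) ⇒ᵇ (a ≟ᵇ b)
  p₂ a b = ((1 ≤ᵇ toℕ a) ∧ (toℕ b ≡ᵇ suc (toℕ a))) ⇒ᵇ π (w zero) (w a) (w b)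
  f : T (isUnderline n π w) → Underline π w
  f h = let h₀ , h′ = to (T-∧ {toℕ (w zero) ≡ᵇ 0}) h
            h₁ , h₂ = to (T-∧ {allᵇ (pts n) (λ a → allᵇ (pts n) (p₁ a))}) h′ in record
    { starts    = toℕ-injective (≡ᵇ⇒≡ _ 0 h₀)
    ; injective = λ {x} {y} e → to T-≟ᵇ (to (T-⇒ {w x ≟ᵇ w y})
        (to (T-all (p₁ x)) (to (T-all (λ a → allᵇ (pts n) (p₁ a))) h₁ x) y) (from T-≟ᵇ e))
    ; chain     = λ l 0<l → to (T-⇒ {(1 ≤ᵇ toℕ (inject₁ l)) ∧ (toℕ (suc l) ≡ᵇ suc (toℕ (inject₁ l)))})
        (to (T-all (p₂ (inject₁ l))) (to (T-all (λ a → allᵇ (pts n) (p₂ a))) h₂ (inject₁ l)) (suc l))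
        (from T-∧ (from T-≤ 0<l , T-adjacent l))
    }
  g : Underline π w → T (isUnderline n π w)
  g u = from (T-∧ {toℕ (w zero) ≡ᵇ 0}) (≡⇒≡ᵇ _ 0 (cong toℕ starts) ,
        from (T-∧ {allᵇ (pts n) (λ a → allᵇ (pts n) (p₁ a))})
          (from (T-all (λ a → allᵇ (pts n) (p₁ a))) (λ a → from (T-all (p₁ a)) λ b →
            from (T-⇒ {w a ≟ᵇ w b}) (λ h → from T-≟ᵇ (injective (to T-≟ᵇ h)))) ,
           from (T-all (λ a → allᵇ (pts n) (p₂ a))) (λ a → from (T-all (p₂ a)) λ b →
            from (T-⇒ {(1 ≤ᵇ toℕ a) ∧ (toℕ b ≡ᵇ suc (toℕ a))}) (step a b))))
    where
    open Underline u
    step : ∀ a b → T ((1 ≤ᵇ toℕ a) ∧ (toℕ b ≡ᵇ suc (toℕ a))) → T (π (w zero) (w a) (w b))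
    step a b h with 0<a , adj ← to (T-∧ {1 ≤ᵇ toℕ a}) h
      with l , refl , refl ← adjacent {k = a} {b} (≡ᵇ⇒≡ _ _ adj) = chain l (to T-≤ 0<a)

cyclicOrder : ∀ {n} → (Pt n → ℕ) → Rel3 n
cyclicOrder κ x y z = cycᵇ (κ x) (κ y) (κ z)

module _ {n} (κ : Pt n → ℕ) where

  T-cyclicOrder : ∀ x y z → T (cyclicOrder κ x y z) ⇔ Cyc (κ x) (κ y) (κ z)
  T-cyclicOrder x y z = T-cycᵇ (κ x) (κ y) (κ z)

  cyclicOrder-total : Inj κ → TotalCyclicOrder (cyclicOrder κ)
  cyclicOrder-total inj = record
    { rotate  = λ {x} {y} {z} h → from (T-cyclicOrder y z x) (Cyc-rotate (to (T-cyclicOrder x y z) h))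
    ; asym    = λ {x} {y} {z} h h′ → Cyc-asym (to (T-cyclicOrder x y z) h) (to (T-cyclicOrder z y x) h′)
    ; transit = λ {x} {y} {z} {u} h h′ →
        from (T-cyclicOrder x y u) (Cyc-trans (to (T-cyclicOrder x y z) h) (to (T-cyclicOrder x z u) h′))
    ; total   = λ {x} {y} {z} x≢y y≢z x≢z →
        Sum.map (from (T-cyclicOrder x y z)) (from (T-cyclicOrder z y x))
          (Cyc-total (x≢y ∘ inj) (y≢z ∘ inj) (x≢z ∘ inj))
    }

  sorts⇒underline : ∀ w → Sorts κ w → w zero ≡ zero → Underline (cyclicOrder κ) w
  sorts⇒underline w s w₀ = record
    { starts = w₀
    ; injective = sorts⇒injective κ w s
    ; chain = λ l 0<l → from (T-cyclicOrder _ _ _) (inj₁ (strictlyMonotone (κ ∘ w) s zero (inject₁ l) 0<l , s l))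
    }

  module _ {π : Rel3 n} {w : Word n} (o : TotalCyclicOrder π) (u : Underline π w) (s : Sorts κ w) where

    open TotalCyclicOrder o
    open Underline u

    private
      -- `chain` relates only neighbouring letters; transitivity based at `w zero` extends it to all
      -- pairs. `m` carries the recursion, as `inject₁ l` is not a structural part of `suc l`.
      from-start : ∀ m a b → toℕ b ≡ m → 0 < toℕ a → toℕ a < toℕ b → T (π (w zero) (w a) (w b))
      from-start (suc m) a (suc l) e 0<a (s≤s a≤l) with <-cmp (toℕ a) (toℕ l)
      ... | tri> _ _ l<a = contradiction l<a (≤⇒≯ a≤l)
      ... | tri≈ _ a≡l _ rewrite toℕ-injective {i = a} {inject₁ l} (trans a≡l (sym (toℕ-inject₁ l))) =
        chain l 0<a
      ... | tri< a<l _ _ = transit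
        (from-start m a (inject₁ l) (trans (toℕ-inject₁ l) (suc-injective e)) 0<a
          (subst (toℕ a <_) (sym (toℕ-inject₁ l)) a<l))
        (chain l (subst (0 <_) (sym (toℕ-inject₁ l)) (<-trans 0<a a<l)))

      increasing : ∀ a b c → toℕ a < toℕ b → toℕ b < toℕ c → T (π (w a) (w b) (w c))
      increasing zero b c a<b b<c = from-start _ b c refl a<b b<c
      -- Seen from `w b`, the cyclic sequence is `w c`, `w zero`, `w a`, so `transit` based at `w b`
      -- removes `w zero`.
      increasing a@(suc _) b c a<b b<c = rotate (rotate (transit
        (rotate (from-start _ b c refl (≤-<-trans z≤n a<b) b<c))
        (rotate (rotate (from-start _ a b refl z<s a<b)))))

      reflects : ∀ a b → κ (w a) < κ (w b) → toℕ a < toℕ b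
      reflects = strictlyMonotone-reflects (κ ∘ w) s

      Cyc⇒π : ∀ a b c → Cyc (κ (w a)) (κ (w b)) (κ (w c)) → T (π (w a) (w b) (w c))
      Cyc⇒π a b c (inj₁ (p , q))        = increasing a b c (reflects a b p) (reflects b c q)
      Cyc⇒π a b c (inj₂ (inj₁ (p , q))) = rotate (rotate (increasing b c a (reflects b c p) (reflects c a q)))
      Cyc⇒π a b c (inj₂ (inj₂ (p , q))) = rotate (increasing c a b (reflects c a p) (reflects a b q))

      cyclicOrder⇒π : ∀ x y z → T (cyclicOrder κ x y z) → T (π x y z)
      cyclicOrder⇒π x y z h
        with a , refl ← injective⇒surjective w injective x
        with b , refl ← injective⇒surjective w injective y
        with c , refl ← injective⇒surjective w injective z = Cyc⇒π a b c (to (T-cyclicOrder _ _ _) h)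

    -- One inclusion is enough: for a triple of `π`, totality of `cyclicOrder κ` offers the triple
    -- or its reverse, and the reverse would lie in `π` as well, against asymmetry.
    underline-determines : Inj κ → ∀ x y z → cyclicOrder κ x y z ≡ π x y z
    underline-determines inj x y z = T-ext (cyclicOrder⇒π x y z) back
      where
      back : T (π x y z) → T (cyclicOrder κ x y z)
      back h with TotalCyclicOrder.total (cyclicOrder-total inj) x≢y y≢z x≢z
        where
        -- With two equal entries some rotation of the triple is a palindrome, contrary to `asym`.
        x≢z : x ≢ z
        x≢z refl = asym h h
        x≢y : x ≢ y
        x≢y refl = asym (rotate h) (rotate h)
        y≢z : y ≢ z
        y≢z refl = asym (rotate (rotate h)) (rotate (rotate h))
      ... | inj₁ p = p
      ... | inj₂ p = contradiction (cyclicOrder⇒π z y x p) (asym h)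

-- What `Cyc` on keys says about the values when the three labels increase: ties are won by the
-- smaller label, so comparisons along the labels are weak and the comparison from the last back to
-- the first is strict.
WeakCyc : ℕ → ℕ → ℕ → Set
WeakCyc p q s = (p ≤ q × q ≤ s) ⊎ (q ≤ s × s < p) ⊎ (s < p × p ≤ q)

-- Addition modulo t + 1

module _ {t : ℕ} where

  -- Addition modulo t + 1 with at most one wrap. The offset is a natural number, not a residue, so
  -- that segment sums can be inserted without reduction.
  Off : Fin (suc t) → ℕ → Fin (suc t) → Set
  Off p b q = toℕ p + b ≡ toℕ q ⊎ toℕ p + b ≡ toℕ q + suc t

  private
    residue : ∀ m → m < suc t + suc t → ∃ λ (q : Fin (suc t)) → m ≡ toℕ q ⊎ m ≡ toℕ q + suc t
    residue m m<2T with m <? suc t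
    ... | yes m<T = fromℕ< m<T , inj₁ (sym (toℕ-fromℕ< m<T))
    ... | no  m≮T = fromℕ< r<T , inj₂ (trans (sym (m∸n+n≡m (≮⇒≥ m≮T))) (cong (_+ suc t) (sym (toℕ-fromℕ< r<T))))
      where
      r<T : m ∸ suc t < suc t
      r<T = +-cancelʳ-< (suc t) _ _ (subst (_< suc t + suc t) (sym (m∸n+n≡m (≮⇒≥ m≮T))) m<2T)

  addition : ∀ (p b : Fin (suc t)) → ∃ (Off p (toℕ b))
  addition p b = residue (toℕ p + toℕ b) (+-mono-< (toℕ<n p) (toℕ<n b))

  subtraction : ∀ (p q : Fin (suc t)) → ∃ λ (b : Fin (suc t)) → Off p (toℕ b) q
  subtraction p q with toℕ p ≤? toℕ q
  ... | yes p≤q = fromℕ< b<T , inj₁ (trans (cong (toℕ p +_) (toℕ-fromℕ< b<T)) (m+[n∸m]≡n p≤q))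
    where
    b<T : toℕ q ∸ toℕ p < suc t
    b<T = ≤-<-trans (m∸n≤m (toℕ q) (toℕ p)) (toℕ<n q)
  ... | no p≰q = fromℕ< b<T , inj₂ (trans (cong (toℕ p +_) (toℕ-fromℕ< b<T)) (m+[n∸m]≡n p≤q+T))
    where
    p≤q+T : toℕ p ≤ toℕ q + suc t
    p≤q+T = ≤-trans (<⇒≤ (toℕ<n p)) (m≤n+m (suc t) (toℕ q))
    b<T : toℕ q + suc t ∸ toℕ p < suc t
    b<T = +-cancelˡ-< (toℕ p) _ _ (subst (_< toℕ p + suc t) (sym (m+[n∸m]≡n p≤q+T)) (+-monoˡ-< (suc t) (≰⇒> p≰q)))

  private
    too-big : ∀ (q : Fin (suc t)) m → toℕ q ≢ m + suc t
    too-big q m e = <⇒≱ (toℕ<n q) (subst (suc t ≤_) (sym e) (m≤n+m (suc t) m))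

  Off-uniqueʳ : ∀ {p b q q′} → Off p b q → Off p b q′ → q ≡ q′
  Off-uniqueʳ {q = q} {q′} (inj₁ e) (inj₁ e′) = toℕ-injective (trans (sym e) e′)
  Off-uniqueʳ {q = q} {q′} (inj₁ e) (inj₂ e′) = contradiction (trans (sym e) e′) (too-big q (toℕ q′))
  Off-uniqueʳ {q = q} {q′} (inj₂ e) (inj₁ e′) = contradiction (trans (sym e′) e) (too-big q′ (toℕ q))
  Off-uniqueʳ {q = q} {q′} (inj₂ e) (inj₂ e′) = toℕ-injective (+-cancelʳ-≡ (suc t) (toℕ q) (toℕ q′) (trans (sym e) e′))

  Off-uniqueᵐ : ∀ {p q} {b b′ : Fin (suc t)} → Off p (toℕ b) q → Off p (toℕ b′) q → b ≡ b′
  Off-uniqueᵐ {p} {q} {b} {b′} = λ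
    { (inj₁ e) (inj₁ e′) → toℕ-injective (+-cancelˡ-≡ (toℕ p) _ _ (trans e (sym e′)))
    ; (inj₁ e) (inj₂ e′) → contradiction (wrap b b′ e e′) (too-big b′ (toℕ b))
    ; (inj₂ e) (inj₁ e′) → contradiction (wrap b′ b e′ e) (too-big b (toℕ b′))
    ; (inj₂ e) (inj₂ e′) → toℕ-injective (+-cancelˡ-≡ (toℕ p) _ _ (trans e (sym e′)))
    }
    where
    wrap : ∀ (b b′ : Fin (suc t)) → toℕ p + toℕ b ≡ toℕ q → toℕ p + toℕ b′ ≡ toℕ q + suc t → toℕ b′ ≡ toℕ b + suc t
    wrap b b′ e e′ = +-cancelˡ-≡ (toℕ p) _ _
      (trans e′ (trans (cong (_+ suc t) (sym e)) (+-assoc (toℕ p) (toℕ b) (suc t))))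

  -- As p ≤ t and a + b ≤ t, two wraps are impossible, and the steps compose without reducing a + b.
  Off-trans-≤ : ∀ {p q s a b} → Off p a q → Off q b s → a + b ≤ t → Off p (a + b) s
  Off-trans-≤ {p} {q} {s} {a} {b} f g a+b≤t = go f g
    where
    go : Off p a q → Off q b s → Off p (a + b) s
    go (inj₁ e) g = Sum.map (trans lhs) (trans lhs) g
      where
      lhs : toℕ p + (a + b) ≡ toℕ q + b
      lhs = trans (sym (+-assoc (toℕ p) a b)) (cong (_+ b) e)
    go (inj₂ e) (inj₁ e′) = inj₂ (trans lhs (cong (_+ suc t) e′))
      where
      lhs : toℕ p + (a + b) ≡ toℕ q + b + suc t
      lhs = trans (sym (+-assoc (toℕ p) a b)) (trans (cong (_+ b) e)
        (solve 3 (λ x y z → x :+ y :+ z := x :+ z :+ y) refl (toℕ q) (suc t) b))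
        where open +-*-Solver
    go (inj₂ e) (inj₂ e′) = contradiction (+-mono-<-≤ (toℕ<n p) (m≤n⇒m≤1+n a+b≤t)) (≤⇒≯ big)
      where
      open ≤-Reasoning
      open +-*-Solver
      big : suc t + suc t ≤ toℕ p + (a + b)
      big = begin
        suc t + suc t             ≤⟨ m≤n+m _ (toℕ s) ⟩
        toℕ s + (suc t + suc t)   ≡⟨ +-assoc (toℕ s) _ _ ⟨
        toℕ s + suc t + suc t     ≡⟨ cong (_+ suc t) e′ ⟨
        toℕ q + b + suc t         ≡⟨ solve 3 (λ x y z → x :+ y :+ z := x :+ z :+ y) refl (toℕ q) b (suc t) ⟩
        toℕ q + suc t + b         ≡⟨ cong (_+ b) e ⟨
        toℕ p + a + b             ≡⟨ +-assoc (toℕ p) a b ⟩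
        toℕ p + (a + b)           ∎

  -- An offset beyond t sheds one full turn. At least one of the two steps wraps, since otherwise
  -- `s` would exceed t; that wrap cancels against the turn, and of two wraps one remains.
  Off-trans-> : ∀ {p q s a b v} → Off p a q → Off q b s → a + b ≡ v + suc t → Off p v s
  Off-trans-> {p} {q} {s} {a} {b} {v} f g ab = go f g
    where
    open ≡-Reasoning
    open +-*-Solver
    lhs : toℕ p + v + suc t ≡ toℕ p + a + b
    lhs = begin
      toℕ p + v + suc t    ≡⟨ +-assoc (toℕ p) v (suc t) ⟩
      toℕ p + (v + suc t)  ≡⟨ cong (toℕ p +_) ab ⟨
      toℕ p + (a + b)      ≡⟨ +-assoc (toℕ p) a b ⟨
      toℕ p + a + b        ∎
    shuffle : toℕ q + suc t + b ≡ toℕ q + b + suc t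
    shuffle = solve 3 (λ x y z → x :+ y :+ z := x :+ z :+ y) refl (toℕ q) (suc t) b
    go : Off p a q → Off q b s → Off p v s
    go (inj₁ e) (inj₁ e′) = contradiction (sym (trans lhs (trans (cong (_+ b) e) e′))) (too-big s (toℕ p + v))
    go (inj₁ e) (inj₂ e′) = inj₁ (+-cancelʳ-≡ (suc t) _ _ (trans lhs (trans (cong (_+ b) e) e′)))
    go (inj₂ e) (inj₁ e′) = inj₁ (+-cancelʳ-≡ (suc t) _ _ (trans lhs
      (trans (cong (_+ b) e) (trans shuffle (cong (_+ suc t) e′)))))
    go (inj₂ e) (inj₂ e′) = inj₂ (+-cancelʳ-≡ (suc t) _ _ (trans lhs
      (trans (cong (_+ b) e) (trans shuffle (cong (_+ suc t) e′)))))

  Off-before : ∀ {p q : Fin (suc t)} {a} → toℕ p + a ≡ toℕ q → toℕ p ≤ toℕ q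
  Off-before {p} {a = a} e = subst (toℕ p ≤_) e (m≤m+n (toℕ p) a)

  Off-wrapped : ∀ {p q : Fin (suc t)} {a} → a ≤ t → toℕ p + a ≡ toℕ q + suc t → toℕ q < toℕ p
  Off-wrapped {p} {q} a≤t e = +-cancelʳ-< (suc t) (toℕ q) (toℕ p) (subst (_< toℕ p + suc t) e (+-monoʳ-< (toℕ p) (s≤s a≤t)))

  private
    unwrapped<wrapped : ∀ {p q s : Fin (suc t)} {a b} → toℕ p + a ≡ toℕ q → toℕ p + b ≡ toℕ s + suc t → a < b
    unwrapped<wrapped {p} {q} {s} {a} {b} e e′ = +-cancelˡ-< (toℕ p) a b
      (subst₂ _<_ (sym e) (sym e′) (<-≤-trans (toℕ<n q) (m≤n+m (suc t) (toℕ s))))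

  -- A triple is in cyclic order exactly when the offsets from its first entry increase.
  WeakCyc⇒≤ : ∀ {p q s a b} → a ≤ t → b ≤ t → Off p a q → Off p b s → WeakCyc (toℕ p) (toℕ q) (toℕ s) → a ≤ b
  WeakCyc⇒≤ {p} {q} {s} {a} {b} a≤t b≤t (inj₁ e) (inj₂ e′) _ = <⇒≤ (unwrapped<wrapped {p} {q} {s} e e′)
  WeakCyc⇒≤ {p} {q} {s} {a} {b} a≤t b≤t (inj₁ e) (inj₁ e′) c = +-cancelˡ-≤ (toℕ p) a b (subst₂ _≤_ (sym e) (sym e′) (q≤s c))
    where
    p≤s = Off-before {p} {s} e′
    q≤s : WeakCyc (toℕ p) (toℕ q) (toℕ s) → toℕ q ≤ toℕ s
    q≤s (inj₁ (_ , r))          = r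
    q≤s (inj₂ (inj₁ (r , _)))   = r
    q≤s (inj₂ (inj₂ (s<p , _))) = contradiction s<p (≤⇒≯ p≤s)
  WeakCyc⇒≤ {p} {q} {s} {a} {b} a≤t b≤t (inj₂ e) (inj₁ e′) = λ
    { (inj₁ (p≤q , _))        → contradiction q<p (≤⇒≯ p≤q)
    ; (inj₂ (inj₁ (_ , s<p))) → contradiction s<p (≤⇒≯ p≤s)
    ; (inj₂ (inj₂ (s<p , _))) → contradiction s<p (≤⇒≯ p≤s)
    }
    where
    q<p = Off-wrapped {p} {q} a≤t e
    p≤s = Off-before {p} {s} e′
  WeakCyc⇒≤ {p} {q} {s} {a} {b} a≤t b≤t (inj₂ e) (inj₂ e′) c =
    +-cancelˡ-≤ (toℕ p) a b (subst₂ _≤_ (sym e) (sym e′) (+-monoˡ-≤ (suc t) (q≤s c)))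
    where
    q<p = Off-wrapped {p} {q} a≤t e
    q≤s : WeakCyc (toℕ p) (toℕ q) (toℕ s) → toℕ q ≤ toℕ s
    q≤s (inj₁ (_ , r))          = r
    q≤s (inj₂ (inj₁ (r , _)))   = r
    q≤s (inj₂ (inj₂ (_ , p≤q))) = contradiction q<p (≤⇒≯ p≤q)

  ≤⇒WeakCyc : ∀ {p q s a b} → a ≤ t → b ≤ t → Off p a q → Off p b s → a ≤ b → WeakCyc (toℕ p) (toℕ q) (toℕ s)
  ≤⇒WeakCyc {p} {q} {s} {a} {b} a≤t b≤t (inj₁ e) (inj₁ e′) a≤b =
    inj₁ (Off-before {p} {q} e , subst₂ _≤_ e e′ (+-monoʳ-≤ (toℕ p) a≤b))
  ≤⇒WeakCyc {p} {q} {s} {a} {b} a≤t b≤t (inj₁ e) (inj₂ e′) a≤b =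
    inj₂ (inj₂ (Off-wrapped {p} {s} b≤t e′ , Off-before {p} {q} e))
  ≤⇒WeakCyc {p} {q} {s} {a} {b} a≤t b≤t (inj₂ e) (inj₁ e′) a≤b =
    contradiction (unwrapped<wrapped {p} {s} {q} e′ e) (≤⇒≯ a≤b)
  ≤⇒WeakCyc {p} {q} {s} {a} {b} a≤t b≤t (inj₂ e) (inj₂ e′) a≤b =
    inj₂ (inj₁ (+-cancelʳ-≤ (suc t) _ _ (subst₂ _≤_ e e′ (+-monoʳ-≤ (toℕ p) a≤b)) , Off-wrapped {p} {s} b≤t e′))

  walk : ∀ {n} → Fin (suc t) → (Fin n → Fin (suc t)) → Fin (suc n) → Fin (suc t)
  walk         p y zero    = p
  walk {suc n} p y (suc k) = walk (proj₁ (addition p (y zero))) (y ∘ suc) k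

  Walk : ∀ {n} → (Fin n → Fin (suc t)) → (Fin (suc n) → Fin (suc t)) → Set
  Walk y ρ = ∀ k → Off (ρ (inject₁ k)) (toℕ (y k)) (ρ (suc k))

  walk-Walk : ∀ {n} p (y : Fin n → Fin (suc t)) → Walk y (walk p y)
  walk-Walk p y zero    = proj₂ (addition p (y zero))
  walk-Walk p y (suc k) = walk-Walk (proj₁ (addition p (y zero))) (y ∘ suc) k

  walk-unique : ∀ {n} p (y : Fin n → Fin (suc t)) ρ → ρ zero ≡ p → Walk y ρ → walk p y ≐ ρ
  walk-unique         p y ρ refl h zero    = refl
  walk-unique {suc n} p y ρ refl h (suc k) = walk-unique _ (y ∘ suc) (ρ ∘ suc)
    (Off-uniqueʳ {p = p} (h zero) (proj₂ (addition p (y zero)))) (h ∘ suc) k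

  increments : ∀ {n} → (Fin (suc n) → Fin (suc t)) → Fin n → Fin (suc t)
  increments ρ k = proj₁ (subtraction (ρ (inject₁ k)) (ρ (suc k)))

  increments-Walk : ∀ {n} (ρ : Fin (suc n) → Fin (suc t)) → Walk (increments ρ) ρ
  increments-Walk ρ k = proj₂ (subtraction (ρ (inject₁ k)) (ρ (suc k)))

-- Stable sorting keys

module _ {n : ℕ} (ρ : Pt n → ℕ) where

  -- Orders the points lexicographically by (ρ x , x).
  key : Pt n → ℕ
  key x = ρ x * suc n + toℕ x

  key-< : ∀ {x y} → ρ x < ρ y → key x < key y
  key-< {x} {y} h = begin-strict
    ρ x * suc n + toℕ x   <⟨ +-monoʳ-< (ρ x * suc n) (toℕ<n x) ⟩
    ρ x * suc n + suc n   ≡⟨ +-comm (ρ x * suc n) (suc n) ⟩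
    suc (ρ x) * suc n     ≤⟨ *-monoˡ-≤ (suc n) h ⟩
    ρ y * suc n           ≤⟨ m≤m+n _ (toℕ y) ⟩
    key y                 ∎
    where open ≤-Reasoning

  key-tie : ∀ {x y} → toℕ x < toℕ y → ρ x ≤ ρ y → key x < key y
  key-tie x<y h = +-mono-≤-< (*-monoˡ-≤ (suc n) h) x<y

  key-≤⁻¹ : ∀ {x y} → key x < key y → ρ x ≤ ρ y
  key-≤⁻¹ h = ≮⇒≥ (λ h′ → <-asym h (key-< h′))

  key-<⁻¹ : ∀ {x y} → toℕ x < toℕ y → key y < key x → ρ y < ρ x
  key-<⁻¹ x<y h = ≰⇒> (λ h′ → <-asym h (key-tie x<y h′))

  key-injective : Inj key
  key-injective {x} {y} e with <-cmp (toℕ x) (toℕ y)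
  ... | tri≈ _ x≡y _ = toℕ-injective x≡y
  ... | tri< x<y _ _ with ρ x ≤? ρ y
  ...   | yes h = contradiction e (<⇒≢ (key-tie x<y h))
  ...   | no  h = contradiction (sym e) (<⇒≢ (key-< (≰⇒> h)))
  key-injective {x} {y} e | tri> _ _ y<x with ρ y ≤? ρ x
  ...   | yes h = contradiction (sym e) (<⇒≢ (key-tie y<x h))
  ...   | no  h = contradiction e (<⇒≢ (key-< (≰⇒> h)))

  -- The source of the descents: a tie is already in the right order when the labels rise, while a
  -- drop of the label forces the value up by at least one.
  key-step : ∀ {x y} → x ≢ y → key x < key y ⇔ ρ x + ind (toℕ y <ᵇ toℕ x) ≤ ρ y
  key-step {x} {y} x≢y with toℕ y <ᵇ toℕ x in eq
  ... | true  = mk⇔ (λ h → subst (_≤ ρ y) (+-comm 1 (ρ x)) (key-<⁻¹ y<x h)) (λ h → key-< (subst (_≤ ρ y) (+-comm (ρ x) 1) h))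
    where
    y<x : toℕ y < toℕ x
    y<x = <ᵇ⇒< _ _ (subst T (sym eq) _)
  ... | false = mk⇔ (λ h → subst (_≤ ρ y) (sym (+-identityʳ (ρ x))) (key-≤⁻¹ h))
                    (λ h → key-tie x<y (subst (_≤ ρ y) (+-identityʳ (ρ x)) h))
    where
    x<y : toℕ x < toℕ y
    x<y = ≤∧≢⇒< (≮⇒≥ (λ y<x → subst T eq (<⇒<ᵇ y<x))) (x≢y ∘ toℕ-injective)

  Cyc⇔WeakCyc : ∀ {x y z} → toℕ x < toℕ y → toℕ y < toℕ z → Cyc (key x) (key y) (key z) ⇔ WeakCyc (ρ x) (ρ y) (ρ z)
  Cyc⇔WeakCyc {x} {y} {z} x<y y<z = mk⇔
    (Sum.map (λ (p , q) → key-≤⁻¹ p , key-≤⁻¹ q)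
      (Sum.map (λ (p , q) → key-≤⁻¹ p , key-<⁻¹ x<z q) (λ (p , q) → key-<⁻¹ x<z p , key-≤⁻¹ q)))
    (Sum.map (λ (p , q) → key-tie x<y p , key-tie y<z q)
      (Sum.map (λ (p , q) → key-tie y<z p , key-< q) (λ (p , q) → key-< p , key-tie x<y q)))
    where
    x<z = <-trans x<y y<z

-- Segment sums and interval chains

T⇒≡true : ∀ {b} → T b → b ≡ true
T⇒≡true = to T-≡

¬T⇒≡false : ∀ {b} → ¬ T b → b ≡ false
¬T⇒≡false {false} h = refl
¬T⇒≡false {true}  h = contradiction _ h

segSum-empty : ∀ {n} (x : Fin n → ℕ) {i j} → j ≤ i → segSum x i j ≡ 0
segSum-empty {n} x {i} {j} j≤i = trans (∑-cong (allFin n) vanish) (∑-0 (allFin n))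
  where
  vanish : ∀ k → (if (i ≤ᵇ toℕ k) ∧ (toℕ k <ᵇ j) then x k else 0) ≡ 0
  vanish k rewrite ¬T⇒≡false {(i ≤ᵇ toℕ k) ∧ (toℕ k <ᵇ j)} (λ h → let i≤k , k<j = to T-∧ h in
    <⇒≱ (to T-< k<j) (≤-trans j≤i (to T-≤ i≤k))) = refl

segSum-suc : ∀ {n} (x : Fin n → ℕ) {i} (l : Fin n) → i ≤ toℕ l → segSum x i (suc (toℕ l)) ≡ segSum x i (toℕ l) + x l
segSum-suc {n} x {i} l i≤l = begin
  ∑ (allFin n) (g (suc (toℕ l)))
    ≡⟨ ∑-cong (allFin n) split ⟩
  ∑ (allFin n) (λ k → g (toℕ l) k + ind (toℕ l ≡ᵇ toℕ k) * x k)
    ≡⟨ ∑-+ (allFin n) (g (toℕ l)) (λ k → ind (toℕ l ≡ᵇ toℕ k) * x k) ⟩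
  ∑ (allFin n) (g (toℕ l)) + ∑ (allFin n) (λ k → ind (toℕ l ≡ᵇ toℕ k) * x k)
    ≡⟨ cong (∑ (allFin n) (g (toℕ l)) +_) (∑-≟ᵇ l x) ⟩
  ∑ (allFin n) (g (toℕ l)) + x l ∎
  where
  open ≡-Reasoning
  g : ℕ → Fin n → ℕ
  g j k = if (i ≤ᵇ toℕ k) ∧ (toℕ k <ᵇ j) then x k else 0
  split : ∀ k → g (suc (toℕ l)) k ≡ g (toℕ l) k + ind (toℕ l ≡ᵇ toℕ k) * x k
  split k with <-cmp (toℕ k) (toℕ l)
  ... | tri< k<l k≢l _
    rewrite T⇒≡true (from T-< (m<n⇒m<1+n k<l)) | T⇒≡true (from T-< k<l)
          | ¬T⇒≡false {toℕ l ≡ᵇ toℕ k} (λ h → k≢l (sym (≡ᵇ⇒≡ _ _ h))) = sym (+-identityʳ _)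
  ... | tri≈ k≮l k≡l _
    rewrite k≡l | T⇒≡true (from T-≤ i≤l) | T⇒≡true (from T-< (n<1+n (toℕ l)))
          | ¬T⇒≡false {toℕ l <ᵇ toℕ l} (λ h → n≮n (toℕ l) (to T-< h))
          | T⇒≡true (≡⇒≡ᵇ (toℕ l) (toℕ l) refl) = sym (+-identityʳ _)
  ... | tri> k≮l k≢l l<k
    rewrite ¬T⇒≡false {toℕ k <ᵇ suc (toℕ l)} (λ h → <⇒≱ l<k (s≤s⁻¹ (to T-< h)))
          | ¬T⇒≡false {toℕ k <ᵇ toℕ l} (λ h → k≮l (to T-< h))
          | ¬T⇒≡false {toℕ l ≡ᵇ toℕ k} (λ h → k≢l (sym (≡ᵇ⇒≡ _ _ h))) = sym (+-identityʳ _)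

-- `l` stands for the neighbours `inject₁ l` and `suc l`; for j = i + 1 there is no such `l`, in
-- agreement with every pair being a chain.
IntervalChain : ∀ {n} → Rel3 n → Pt n → Pt n → Set
IntervalChain π i j = ∀ l → toℕ i < toℕ l → toℕ l < toℕ j → T (π i (inject₁ l) (suc l))

T-intervalChain : ∀ {n} (π : Rel3 n) i j → T (intervalChain n π i j) ⇔ IntervalChain π i j
T-intervalChain {n} π i j = mk⇔ f g
  where
  c p : Pt n → Pt n → Bool
  c k k′ = (toℕ i <ᵇ toℕ k) ∧ (toℕ k′ ≡ᵇ suc (toℕ k)) ∧ (toℕ k′ ≤ᵇ toℕ j)
  p k k′ = c k k′ ⇒ᵇ π i k k′
  f : T (intervalChain n π i j) → IntervalChain π i j
  f h l i<l l<j = to (T-⇒ {c (inject₁ l) (suc l)})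
    (to (T-all (p (inject₁ l))) (to (T-all (λ k → allᵇ (pts n) (p k))) h (inject₁ l)) (suc l))
    (from (T-∧ {toℕ i <ᵇ toℕ (inject₁ l)}) (from T-< (subst (toℕ i <_) (sym (toℕ-inject₁ l)) i<l) ,
      from (T-∧ {toℕ (suc l) ≡ᵇ suc (toℕ (inject₁ l))}) (T-adjacent l , from T-≤ l<j)))
  g : IntervalChain π i j → T (intervalChain n π i j)
  g h = from (T-all (λ k → allᵇ (pts n) (p k))) λ k → from (T-all (p k)) λ k′ → from (T-⇒ {c k k′}) (step k k′)
    where
    step : ∀ k k′ → T (c k k′) → T (π i k k′)
    step k k′ q with i<k , q′ ← to (T-∧ {toℕ i <ᵇ toℕ k}) q with adj , k′≤j ← to (T-∧ {toℕ k′ ≡ᵇ suc (toℕ k)}) q′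
      with l , refl , refl ← adjacent {k = k} {k′} (≡ᵇ⇒≡ _ _ adj) =
      h l (subst (toℕ i <_) (toℕ-inject₁ l) (to T-< i<k)) (to T-≤ k′≤j)

module _ {n t : ℕ} (y : Fin n → Fin (suc t)) where

  position : Pt n → Fin (suc t)
  position = walk zero y

  stableKey : Pt n → ℕ
  stableKey = key (toℕ ∘ position)

  private
    seg : Pt n → Pt n → ℕ
    seg i k = segSum (toℕ ∘ y) (toℕ i) (toℕ k)

    seg-suc : ∀ i l → toℕ i ≤ toℕ l → seg i (suc l) ≡ seg i (inject₁ l) + toℕ (y l)
    seg-suc i l i≤l = trans (segSum-suc (toℕ ∘ y) l i≤l)
      (cong (λ z → segSum (toℕ ∘ y) (toℕ i) z + toℕ (y l)) (sym (toℕ-inject₁ l)))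

    seg-self : ∀ i k → toℕ k ≡ toℕ i → seg i k ≡ 0
    seg-self i k k≡i = segSum-empty (toℕ ∘ y) (≤-reflexive k≡i)

    seg-mono : ∀ i m k j → toℕ j ≡ m → toℕ i ≤ toℕ k → toℕ k ≤ toℕ j → seg i k ≤ seg i j
    seg-mono i m k j e i≤k k≤j with m≤n⇒m<n∨m≡n k≤j
    ... | inj₂ k≡j = ≤-reflexive (cong (seg i) (toℕ-injective k≡j))
    seg-mono i (suc m) k (suc l) e i≤k k≤j | inj₁ (s≤s k≤l) = begin
      seg i k                        ≤⟨ seg-mono i m k (inject₁ l) (trans (toℕ-inject₁ l) (suc-injective e)) i≤k
                                          (subst (toℕ k ≤_) (sym (toℕ-inject₁ l)) k≤l) ⟩
      seg i (inject₁ l)              ≤⟨ m≤m+n _ _ ⟩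
      seg i (inject₁ l) + toℕ (y l)  ≡⟨ seg-suc i l (≤-trans i≤k k≤l) ⟨
      seg i (suc l)                  ∎
      where open ≤-Reasoning

    -- From the trivial offset at `i`, each step adds `y l` by `Off-trans-≤`. The total stays within
    -- t, hence so does every shorter sum, and no reduction takes place.
    seg-Off : ∀ i m k → toℕ k ≡ m → toℕ i ≤ toℕ k → seg i k ≤ t → Off (position i) (seg i k) (position k)
    seg-Off i m k e i≤k s≤t with m≤n⇒m<n∨m≡n i≤k
    ... | inj₂ i≡k rewrite toℕ-injective i≡k = inj₁ (trans (cong (toℕ (position k) +_) (seg-self k k refl)) (+-identityʳ _))
    seg-Off i (suc m) (suc l) e i≤k s≤t | inj₁ (s≤s i≤l) =
      subst (λ z → Off (position i) z (position (suc l))) (sym (seg-suc i l i≤l))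
        (Off-trans-≤ {p = position i} {position (inject₁ l)}
          (seg-Off i m (inject₁ l) (trans (toℕ-inject₁ l) (suc-injective e)) (subst (toℕ i ≤_) (sym (toℕ-inject₁ l)) i≤l)
            (≤-trans (m≤m+n _ _) sum≤t))
          (walk-Walk zero y l) sum≤t)
      where
      sum≤t : seg i (inject₁ l) + toℕ (y l) ≤ t
      sum≤t = subst (_≤ t) (seg-suc i l i≤l) s≤t

    labels : ∀ {i : Pt n} {l : Fin n} → toℕ i < toℕ l → toℕ i < toℕ (inject₁ l) × toℕ (inject₁ l) < toℕ (suc l)
    labels {i} {l} i<l = subst (toℕ i <_) (sym (toℕ-inject₁ l)) i<l , s≤s (≤-reflexive (toℕ-inject₁ l))

  -- Both partial sums are unreduced offsets from `position i`, and they increase, which is cyclic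
  -- order of the three positions.
  ≤t⇒chain : ∀ i j → seg i j ≤ t → IntervalChain (cyclicOrder stableKey) i j
  ≤t⇒chain i j s≤t l i<l l<j = from (T-cyclicOrder stableKey i (inject₁ l) (suc l))
    (from (Cyc⇔WeakCyc (toℕ ∘ position) (proj₁ (labels {i} i<l)) (proj₂ (labels {i} i<l)))
      (≤⇒WeakCyc {p = position i} {position (inject₁ l)} {position (suc l)} a≤t b≤t
        (seg-Off i _ (inject₁ l) refl i≤l a≤t) (seg-Off i _ (suc l) refl i≤sl b≤t) a≤b))
    where
    i≤l  = <⇒≤ (proj₁ (labels {i} i<l))
    i≤sl = <⇒≤ (<-trans i<l (n<1+n (toℕ l)))
    b≤t : seg i (suc l) ≤ t
    b≤t = ≤-trans (seg-mono i _ (suc l) j refl i≤sl l<j) s≤t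
    a≤b : seg i (inject₁ l) ≤ seg i (suc l)
    a≤b = seg-mono i _ (inject₁ l) (suc l) refl i≤l (<⇒≤ (proj₂ (labels {i} i<l)))
    a≤t = ≤-trans a≤b b≤t

  -- Induction along the interval. If the sum `a` before a step is at most t and the next sum
  -- exceeds t, the walk has completed a turn and its offset falls to a + y l - (t + 1) < a, so this
  -- step breaks the chain.
  chain⇒≤t : ∀ i j → toℕ i < toℕ j → IntervalChain (cyclicOrder stableKey) i j → seg i j ≤ t
  chain⇒≤t i j i<j h = go _ j refl i<j ≤-refl
    where
    go : ∀ m k → toℕ k ≡ m → toℕ i < toℕ k → toℕ k ≤ toℕ j → seg i k ≤ t
    go (suc m) (suc l) e (s≤s i≤l) k≤j with m≤n⇒m<n∨m≡n i≤l
    -- The chain is silent about the first step; the bound is that of the single coordinate `y l`.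
    ... | inj₂ i≡l = begin
      seg i (suc l)                    ≡⟨ seg-suc i l i≤l ⟩
      seg i (inject₁ l) + toℕ (y l)    ≡⟨ cong (_+ toℕ (y l)) (seg-self i (inject₁ l) (trans (toℕ-inject₁ l) (sym i≡l))) ⟩
      toℕ (y l)                        ≤⟨ toℕ≤pred[n] (y l) ⟩
      t                                ∎
      where open ≤-Reasoning
    ... | inj₁ i<l = ≮⇒≥ λ t<s → let
        v      = seg i (suc l) ∸ suc t
        sum≡v+T = trans (sym (seg-suc i l i≤l)) (sym (m∸n+n≡m t<s))
        v<a    : v < a
        -- A single step is shorter than a full turn.
        v<a    = +-cancelʳ-< (suc t) v a (subst (_< a + suc t) sum≡v+T (+-monoʳ-< a (toℕ<n (y l))))
        a≤v    = WeakCyc⇒≤ {p = position i} {position (inject₁ l)} {position (suc l)}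
                   a≤t (≤-trans (<⇒≤ v<a) a≤t) a-Off
                   (Off-trans-> {p = position i} {position (inject₁ l)} a-Off (walk-Walk zero y l) sum≡v+T)
                   (to (Cyc⇔WeakCyc (toℕ ∘ position) (proj₁ (labels {i} i<l)) (proj₂ (labels {i} i<l)))
                     (to (T-cyclicOrder stableKey i (inject₁ l) (suc l)) (h l i<l k≤j)))
      in <⇒≱ v<a a≤v
      where
      a : ℕ
      a = seg i (inject₁ l)
      a≤t : a ≤ t
      a≤t = go m (inject₁ l) (trans (toℕ-inject₁ l) (suc-injective e)) (proj₁ (labels {i} i<l))
        (≤-trans (<⇒≤ (proj₂ (labels {i} i<l))) k≤j)
      a-Off = seg-Off i _ (inject₁ l) refl (<⇒≤ (proj₁ (labels {i} i<l))) a≤t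

-- Descents and compatible sequences

descent : ∀ {n} → Word n → Fin n → ℕ
descent w l = ind (toℕ (w (suc l)) <ᵇ toℕ (w (inject₁ l)))

des≡∑descent : ∀ {n} (w : Word n) → des n w ≡ ∑ (allFin n) (descent w)
des≡∑descent {n} w = begin
  des n w
    ≡⟨ count≡∑ (cartesianProduct (pts n) (pts n)) dᵇ ⟩
  ∑ (cartesianProduct (pts n) (pts n)) (ind ∘ dᵇ)
    ≡⟨ ∑-cartesianProduct (pts n) (pts n) (ind ∘ dᵇ) ⟩
  ∑ (pts n) (λ a → ∑ (pts n) (λ b → D a b))
    ≡⟨ ∑-swap (pts n) (pts n) D ⟩
  ∑ (pts n) (λ b → ∑ (pts n) (λ a → D a b))
    ≡⟨ ∑-allFin-suc (λ b → ∑ (pts n) (λ a → D a b)) ⟩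
  -- No pair of consecutive positions ends at position 0; for `b = suc l` the only surviving `a` is
  -- `inject₁ l`.
  ∑ (pts n) (λ a → 0) + ∑ (allFin n) (λ l → ∑ (pts n) (λ a → D a (suc l)))
    ≡⟨ cong₂ _+_ (∑-0 (pts n))
         (∑-cong (allFin n) (λ l → trans (∑-cong (pts n) (at l)) (∑-≟ᵇ (inject₁ l) (λ a → ind (toℕ (w (suc l)) <ᵇ toℕ (w a)))))) ⟩
  ∑ (allFin n) (descent w) ∎
  where
  open ≡-Reasoning
  dᵇ : Pt n × Pt n → Bool
  dᵇ (a , b) = (toℕ b ≡ᵇ suc (toℕ a)) ∧ (toℕ (w b) <ᵇ toℕ (w a))
  D : Pt n → Pt n → ℕ
  D a b = ind (dᵇ (a , b))
  at : ∀ l a → D a (suc l) ≡ ind (toℕ (inject₁ l) ≡ᵇ toℕ a) * ind (toℕ (w (suc l)) <ᵇ toℕ (w a))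
  at l a = trans (ind-∧ (toℕ l ≡ᵇ toℕ a) _)
    (cong (λ z → ind (z ≡ᵇ toℕ a) * ind (toℕ (w (suc l)) <ᵇ toℕ (w a))) (sym (toℕ-inject₁ l)))

-- `g` includes the initial bound as its value at `zero`, so that the first step reads like all
-- others.
T-climbs : ∀ {n t} (d : Fin n → ℕ) (c : Fin n → Fin t) (g : Fin (suc n) → ℕ) → (∀ l → g (suc l) ≡ toℕ (c l)) →
  T (climbs (g zero) d c) ⇔ (∀ l → g (inject₁ l) + d l ≤ g (suc l))
T-climbs {zero}  d c g e = mk⇔ (λ _ ()) _
T-climbs {suc n} d c g e rewrite sym (e zero) = mk⇔
  (λ h → λ { zero → to T-≤ (proj₁ (to T-∧ h)) ; (suc l) → to rest (proj₂ (to (T-∧ {g zero + d zero ≤ᵇ g (suc zero)}) h)) l })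
  (λ h → from T-∧ (from T-≤ (h zero) , from rest (h ∘ suc)))
  where
  rest = T-climbs (d ∘ suc) (c ∘ suc) (g ∘ suc) (e ∘ suc)

sortsᵇ : ∀ {n} → (Pt n → ℕ) → Word n → Bool
sortsᵇ κ w = allFinᵇ λ l → κ (w (inject₁ l)) <ᵇ κ (w (suc l))

T-sortsᵇ : ∀ {n} (κ : Pt n → ℕ) w → T (sortsᵇ κ w) ⇔ Sorts κ w
T-sortsᵇ κ w = mk⇔ (λ h l → to T-< (to (T-allFinᵇ p) h l)) (λ h → from (T-allFinᵇ p) (λ l → from T-< (h l)))
  where
  p = λ l → κ (w (inject₁ l)) <ᵇ κ (w (suc l))

module _ {n t : ℕ} (w : Word n) (w₀ : w zero ≡ zero) (w-inj : Inj w) where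

  private
    σ : Word n
    σ x = proj₁ (injective⇒surjective w w-inj x)

    wσ : ∀ x → w (σ x) ≡ x
    wσ x = proj₂ (injective⇒surjective w w-inj x)

    σw : ∀ a → σ (w a) ≡ a
    σw a = w-inj (wσ (w a))

    -- The 0 in front is the position of the letter `w zero`, the start of the walk.
    hat : (Fin n → Fin (suc t)) → Pt n → Fin (suc t)
    hat c zero    = zero
    hat c (suc l) = c l

    -- Mutually inverse up to `≐` between `P` and `Q`: `sequence` reads the positions in the order
    -- of `w`, `points` puts the values back on the labels by `σ` and takes differences modulo t +
    -- 1.
    sequence points : (Fin n → Fin (suc t)) → Fin n → Fin (suc t)
    sequence y = position y ∘ w ∘ suc
    points c = increments (hat c ∘ σ)

    P Q : (Fin n → Fin (suc t)) → Bool
    P y = sortsᵇ (stableKey y) w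
    Q c = climbs 0 (descent w) c

    -- By `key-step`, sortedness at neighbouring letters is a rise by at least the descent
    -- indicator.
    matching : ∀ {y c} → position y ∘ w ≐ hat c → T (P y) ⇔ T (Q c)
    matching {y} {c} e = mk⇔
      (λ h → from climbing (λ l → subst₂ (λ a b → toℕ a + descent w l ≤ toℕ b) (e (inject₁ l)) (e (suc l))
        (to (step l) (to (T-sortsᵇ (stableKey y) w) h l))))
      (λ h → from (T-sortsᵇ (stableKey y) w) (λ l → from (step l)
        (subst₂ (λ a b → toℕ a + descent w l ≤ toℕ b) (sym (e (inject₁ l))) (sym (e (suc l))) (to climbing h l))))
      where
      climbing = T-climbs (descent w) c (toℕ ∘ hat c) (λ _ → refl)
      distinct : ∀ l → w (inject₁ l) ≢ w (suc l)
      distinct l eq = 1+n≢n (sym (trans (sym (toℕ-inject₁ l)) (cong toℕ (w-inj eq))))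
      step = λ l → key-step (toℕ ∘ position y) (distinct l)

    to′ : ∀ {y c} → sequence y ≐ c → T (P y) → points c ≐ y × T (Q c)
    -- Two consecutive residues determine the increment between them, which recovers `y`.
    to′ {y} {c} e p = (λ k → Off-uniqueᵐ {p = hat c (σ (inject₁ k))} {hat c (σ (suc k))}
        (increments-Walk (hat c ∘ σ) k)
        (subst₂ (λ a b → Off a (toℕ (y k)) b) (e″ (inject₁ k)) (e″ (suc k)) (walk-Walk zero y k)))
      , to (matching e′) p
      where
      e′ : position y ∘ w ≐ hat c
      e′ zero    = cong (position y) w₀
      e′ (suc l) = e l
      e″ : position y ≐ hat c ∘ σ
      e″ x = trans (cong (position y) (sym (wσ x))) (e′ (σ x))

    from′ : ∀ {y c} → points c ≐ y → T (Q c) → sequence y ≐ c × T (P y)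
    from′ {y} {c} e q = e′ ∘ suc , from (matching e′) q
      where
      -- As `w` starts with 0, the label 0 receives the value 0, where `position` begins its walk.
      start : hat c (σ zero) ≡ zero
      start = cong (hat c) (trans (cong σ (sym w₀)) (σw zero))
      e′ : position y ∘ w ≐ hat c
      e′ a = trans (walk-unique zero y (hat c ∘ σ) start
        (λ k → subst (λ b → Off (hat c (σ (inject₁ k))) (toℕ b) (hat c (σ (suc k)))) (e k) (increments-Walk (hat c ∘ σ) k)) (w a))
        (cong (hat c) (σw a))

  -- For a fixed `w` the sequences fill a half-open simplex with Ehrhart series z^(des w)/(1 - z)^(n
  -- + 1).
  ∑-sorted : ∑ (funs n (allFin (suc t))) (λ y → ind (sortsᵇ (stableKey y) w)) ≡ S^ (suc n) (δ (des n w)) t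
  ∑-sorted = begin
    ∑ (funs n (allFin (suc t))) (ind ∘ P)       ≡⟨ ∑-bijection sequence points P Q to′ from′ ⟩
    ∑ (funs n (allFin (suc t))) (ind ∘ Q)       ≡⟨ ∑-climbs n t (descent w) refl ⟩
    S^ (suc n) (δ (∑ (allFin n) (descent w))) t ≡⟨ cong (λ d → S^ (suc n) (δ d) t) (des≡∑descent w) ⟨
    S^ (suc n) (δ (des n w)) t                  ∎
    where open ≡-Reasoning

-- Decomposition of the dilated polytope

sorts⇒starts : ∀ {n} (κ : Pt n → ℕ) w → κ zero ≡ 0 → Inj κ → Sorts κ w → w zero ≡ zero
sorts⇒starts κ w κ₀ κ-inj s with injective⇒surjective w (sorts⇒injective κ w s) zero
... | zero  , e = e
... | suc a , e = contradiction (subst (κ (w zero) <_) (trans (cong κ e) κ₀) (strictlyMonotone (κ ∘ w) s zero (suc a) z<s)) n≮0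

TotalCyclicOrder-resp : ∀ {n} {π ρ : Rel3 n} → (∀ x y z → π x y z ≡ ρ x y z) → TotalCyclicOrder π → TotalCyclicOrder ρ
TotalCyclicOrder-resp {π = π} {ρ} e o = record
  { rotate  = λ p → f (rotate (b p))
  ; asym    = λ p q → asym (b p) (b q)
  ; transit = λ p q → f (transit (b p) (b q))
  ; total   = λ p q r → Sum.map f f (total p q r)
  }
  where
  open TotalCyclicOrder o
  f : ∀ {x y z} → T (π x y z) → T (ρ x y z)
  f {x} {y} {z} = subst T (e x y z)
  b : ∀ {x y z} → T (ρ x y z) → T (π x y z)
  b {x} {y} {z} = subst T (sym (e x y z))

module _ {n : ℕ} (I : Pt n → Pt n → Bool) (I-< : ∀ i j → I i j ≡ true → toℕ i < toℕ j) where

  chains : Rel3 n → Bool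
  chains π = allᵇ (pts n) (λ i → allᵇ (pts n) (λ j → I i j ⇒ᵇ intervalChain n π i j))

  T-chains : ∀ π → T (chains π) ⇔ (∀ i j → T (I i j) → IntervalChain π i j)
  T-chains π = mk⇔
    (λ h i j q → to (T-intervalChain π i j) (to (T-⇒ {I i j}) (to (T-all (p i)) (to (T-all (λ i → allᵇ (pts n) (p i))) h i) j) q))
    (λ h → from (T-all (λ i → allᵇ (pts n) (p i))) λ i → from (T-all (p i)) λ j →
      from (T-⇒ {I i j}) (λ q → from (T-intervalChain π i j) (h i j q)))
    where
    p : Pt n → Pt n → Bool
    p i j = I i j ⇒ᵇ intervalChain n π i j

  pair : Rel3 n × Word n → Bool
  pair (π , w) = inA n I π ∧ isUnderline n π w

  module _ {t : ℕ} where

    inside : (Fin n → Fin (suc t)) → Bool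
    inside y = allᵇ (pts n) λ i → allᵇ (pts n) λ j →
      I i j ⇒ᵇ (segSum (λ k → toℕ (y k)) (toℕ i) (toℕ j) ≤ᵇ t)

    T-inside : ∀ y → T (inside y) ⇔ (∀ i j → T (I i j) → IntervalChain (cyclicOrder (stableKey y)) i j)
    T-inside y = mk⇔
      (λ h i j q → ≤t⇒chain y i j (to T-≤ (to (T-⇒ {I i j}) (to (T-all (p i)) (to (T-all (λ i → allᵇ (pts n) (p i))) h i) j) q)))
      (λ h → from (T-all (λ i → allᵇ (pts n) (p i))) λ i → from (T-all (p i)) λ j →
        from (T-⇒ {I i j}) (λ q → from T-≤ (chain⇒≤t y i j (I-< i j (T⇒≡true q)) (h i j q))))
      where
      p : Pt n → Pt n → Bool
      p i j = I i j ⇒ᵇ (segSum (λ k → toℕ (y k)) (toℕ i) (toℕ j) ≤ᵇ t)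

    module _ (y : Fin n → Fin (suc t)) where

      private
        κ : Pt n → ℕ
        κ = stableKey y
        κ-inj : Inj κ
        κ-inj = key-injective (toℕ ∘ position y)
        w* : Word n
        w* = proj₁ (sorting κ κ-inj)
        w*-sorts : Sorts κ w*
        w*-sorts = proj₂ (sorting κ κ-inj)
        π* : Rel3 n
        π* = cyclicOrder κ

      -- Being sorted by `w` ties a pair to `y`: a key has only one sorting word, and a total cyclic
      -- order with that word as underline is the one of the key. The interval chains of this order
      -- then express membership in the dilate.
      pair-unique : ∀ π w → (pair (π , w) ∧ sortsᵇ κ w) ≡ (inside y ∧ (π* ≗ᵇ π) ∧ (w* ≐ᵇ w))
      pair-unique π w = T-ext f g
        where
        f : T (pair (π , w) ∧ sortsᵇ κ w) → T (inside y ∧ (π* ≗ᵇ π) ∧ (w* ≐ᵇ w))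
        f h = from (T-∧ {inside y}) (from (T-inside y) (λ i j q l i<l l<j →
                subst T (sym (eq i (inject₁ l) (suc l))) (to (T-chains π) cs i j q l i<l l<j)) ,
              from (T-∧ {π* ≗ᵇ π}) (from (T-≗ᵇ π* π) eq ,
              from (T-≐ᵇ {f = w*} {w}) (sorts-unique κ w* w w*-sorts s)))
          where
          h₁ = to (T-∧ {pair (π , w)}) h
          h₂ = to (T-∧ {inA n I π}) (proj₁ h₁)
          h₃ = to (T-∧ {isTotalCyclicOrder n π}) (proj₁ h₂)
          cs = proj₂ h₃
          s = to (T-sortsᵇ κ w) (proj₂ h₁)
          eq = underline-determines κ (to (T-isTotalCyclicOrder π) (proj₁ h₃)) (to (T-isUnderline π w) (proj₂ h₂)) s κ-inj
        g : T (inside y ∧ (π* ≗ᵇ π) ∧ (w* ≐ᵇ w)) → T (pair (π , w) ∧ sortsᵇ κ w)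
        g h = from (T-∧ {pair (π , w)}) (from (T-∧ {inA n I π}) (
                from (T-∧ {isTotalCyclicOrder n π})
                  (from (T-isTotalCyclicOrder π) (TotalCyclicOrder-resp eq (cyclicOrder-total κ κ-inj)) ,
                   from (T-chains π) (λ i j q l i<l l<j →
                     subst T (eq i (inject₁ l) (suc l)) (to (T-inside y) (proj₁ h₁) i j q l i<l l<j))) ,
                from (T-isUnderline π w) (record
                  { starts    = Underline.starts u
                  ; injective = Underline.injective u
                  ; chain     = λ l 0<l → subst T (eq _ _ _) (Underline.chain u l 0<l) })) ,
              from (T-sortsᵇ κ w) s)
          where
          h₁ = to (T-∧ {inside y}) h
          h₂ = to (T-∧ {π* ≗ᵇ π}) (proj₂ h₁)
          eq = to (T-≗ᵇ π* π) (proj₁ h₂)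
          w≐ = to (T-≐ᵇ {f = w*} {w}) (proj₂ h₂)
          s : Sorts κ w
          s l = subst₂ (λ a b → κ a < κ b) (w≐ (inject₁ l)) (w≐ (suc l)) (w*-sorts l)
          -- `refl`: the walk starts at residue 0 and the label is 0, so the key of `zero` is 0.
          u = sorts⇒underline κ w s (sorts⇒starts κ w refl κ-inj s)

      ∑-pairs : ∑ (cartesianProduct (allRel3 n) (allWords n)) (λ pw → ind (pair pw) * ind (sortsᵇ κ (proj₂ pw))) ≡ ind (inside y)
      ∑-pairs = begin
        ∑ (cartesianProduct (allRel3 n) (allWords n)) (λ pw → ind (pair pw) * ind (sortsᵇ κ (proj₂ pw)))
          ≡⟨ ∑-cartesianProduct (allRel3 n) (allWords n) (λ pw → ind (pair pw) * ind (sortsᵇ κ (proj₂ pw))) ⟩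
        ∑ (allRel3 n) (λ π → ∑ (allWords n) (λ w → ind (pair (π , w)) * ind (sortsᵇ κ w)))
          ≡⟨ ∑-cong (allRel3 n) (λ π → ∑-cong (allWords n) (pointwise π)) ⟩
        ∑ (allRel3 n) (λ π → ∑ (allWords n) (λ w → ind (inside y) * ind (π* ≗ᵇ π) * ind (w* ≐ᵇ w)))
          ≡⟨ ∑-cong (allRel3 n) (λ π → trans (∑-*ˡ (allWords n) (ind (inside y) * ind (π* ≗ᵇ π)) (λ w → ind (w* ≐ᵇ w)))
               (trans (cong (ind (inside y) * ind (π* ≗ᵇ π) *_) (∑-≐ᵇ w*)) (*-identityʳ _))) ⟩
        ∑ (allRel3 n) (λ π → ind (inside y) * ind (π* ≗ᵇ π))
          ≡⟨ ∑-*ˡ (allRel3 n) (ind (inside y)) (λ π → ind (π* ≗ᵇ π)) ⟩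
        ind (inside y) * ∑ (allRel3 n) (λ π → ind (π* ≗ᵇ π))
          ≡⟨ cong (ind (inside y) *_) (∑-≗ᵇ π*) ⟩
        ind (inside y) * 1
          ≡⟨ *-identityʳ _ ⟩
        ind (inside y) ∎
        where
        open ≡-Reasoning
        pointwise : ∀ π w → ind (pair (π , w)) * ind (sortsᵇ κ w) ≡ ind (inside y) * ind (π* ≗ᵇ π) * ind (w* ≐ᵇ w)
        pointwise π w = begin
          ind (pair (π , w)) * ind (sortsᵇ κ w)                 ≡⟨ ind-∧ (pair (π , w)) (sortsᵇ κ w) ⟨
          ind (pair (π , w) ∧ sortsᵇ κ w)                       ≡⟨ cong ind (pair-unique π w) ⟩
          ind (inside y ∧ (π* ≗ᵇ π) ∧ (w* ≐ᵇ w))                ≡⟨ ind-∧ (inside y) _ ⟩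
          ind (inside y) * ind ((π* ≗ᵇ π) ∧ (w* ≐ᵇ w))          ≡⟨ cong (ind (inside y) *_) (ind-∧ (π* ≗ᵇ π) (w* ≐ᵇ w)) ⟩
          ind (inside y) * (ind (π* ≗ᵇ π) * ind (w* ≐ᵇ w))      ≡⟨ *-assoc (ind (inside y)) (ind (π* ≗ᵇ π)) _ ⟨
          ind (inside y) * ind (π* ≗ᵇ π) * ind (w* ≐ᵇ w)        ∎

  descentCount≡∑ : ∀ m → descentCount n I m ≡
    ∑ (cartesianProduct (allRel3 n) (allWords n)) (λ pw → ind (pair pw) * δ (des n (proj₂ pw)) m)
  descentCount≡∑ m = trans (count≡∑ (cartesianProduct (allRel3 n) (allWords n)) counted)
    (∑-cong (cartesianProduct (allRel3 n) (allWords n)) split)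
    where
    counted : Rel3 n × Word n → Bool
    counted (π , w) = inA n I π ∧ isUnderline n π w ∧ (des n w ≡ᵇ m)
    split : ∀ pw → ind (counted pw) ≡ ind (pair pw) * δ (des n (proj₂ pw)) m
    split (π , w) with inA n I π
    ... | false = refl
    ... | true  = ind-∧ (isUnderline n π w) (des n w ≡ᵇ m)

  -- Double count of the incidences of points and pairs; linearity of `S^` then collects the
  -- simplices into the descent polynomial.
  ehrhart≡S^ : ehrhart n I ≐ S^ (suc n) (descentCount n I)
  ehrhart≡S^ t = begin
    ehrhart n I t
      ≡⟨ count≡∑ Y inside ⟩
    ∑ Y (λ y → ind (inside y))
      ≡⟨ ∑-cong Y (λ y → sym (∑-pairs y)) ⟩
    ∑ Y (λ y → ∑ Z (λ pw → ind (pair pw) * ind (sortsᵇ (stableKey y) (proj₂ pw))))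
      ≡⟨ ∑-swap Y Z (λ y pw → ind (pair pw) * ind (sortsᵇ (stableKey y) (proj₂ pw))) ⟩
    ∑ Z (λ pw → ∑ Y (λ y → ind (pair pw) * ind (sortsᵇ (stableKey y) (proj₂ pw))))
      ≡⟨ ∑-cong Z (λ pw → trans (∑-*ˡ Y (ind (pair pw)) (λ y → ind (sortsᵇ (stableKey y) (proj₂ pw)))) (simplex pw)) ⟩
    ∑ Z (λ pw → ind (pair pw) * S^ (suc n) (δ (des n (proj₂ pw))) t)
      ≡⟨ S^-∑ (suc n) Z (ind ∘ pair) (λ pw → δ (des n (proj₂ pw))) t ⟨
    S^ (suc n) (λ m → ∑ Z (λ pw → ind (pair pw) * δ (des n (proj₂ pw)) m)) t
      ≡⟨ S^-cong (suc n) descentCount≡∑ t ⟨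
    S^ (suc n) (descentCount n I) t ∎
    where
    open ≡-Reasoning
    Y = funs n (allFin (suc t))
    Z = cartesianProduct (allRel3 n) (allWords n)
    simplex : ∀ pw → ind (pair pw) * ∑ Y (λ y → ind (sortsᵇ (stableKey y) (proj₂ pw))) ≡
                     ind (pair pw) * S^ (suc n) (δ (des n (proj₂ pw))) t
    -- `∑-sorted` asks for an injective word starting with 0. Both come from `pair`, and where
    -- `pair` fails the weight is 0.
    simplex (π , w) with pair (π , w) in eq
    ... | false = refl
    ... | true  = cong (1 *_) (∑-sorted w (Underline.starts u) (Underline.injective u))
      where
      u = to (T-isUnderline π w) (proj₂ (to (T-∧ {inA n I π}) (subst T (sym eq) _)))


open import Data.Integer using (+_)

theorem2p9 : (n : ℕ) → 1 ≤ n →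
    (I : Pt n → Pt n → Bool) →
    (∀ i j → I i j ≡ true → toℕ i < toℕ j) →
    (m : ℕ) → hstarCoeff n (ehrhart n I) m ≡ + (descentCount n I m)
theorem2p9 n _ I I-< m = begin
  hstarCoeff n (ehrhart n I) m                         ≡⟨ hstarCoeff≡differences n (ehrhart n I) m ⟩
  differences (suc n) (ehrhart n I) m                  ≡⟨ differences-cong (suc n) (ehrhart≡S^ I I-<) m ⟩
  differences (suc n) (S^ (suc n) (descentCount n I)) m ≡⟨ differences-S^ (suc n) (descentCount n I) m ⟩
  + (descentCount n I m)                               ∎
  where open ≡-Reasoning
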